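{- Let $G$ be a planar graph with girth $g \geq 6$ and maximum degree $\Delta$. Then $\chi'_s(G) \leq 3\Delta + 1$.
   Context: Graphs are finite and simple. The girth of a graph is the length of a shortest cycle in it. A strong edge-colouring of a graph $G$ is a proper edge-colouring of $G$ (adjacent edges receive different colours) in which every colour class induces a matching; equivalently, any two edges that share an endpoint or are joined by a third edge receive different colours. The strong chromatic index $\chi'_s(G)$ is the smallest integer $k$ such that $G$ admits a strong edge-colouring with $k$ colours. $\Delta$ denotes the maximum degree of $G$. -}

module Defs where

open import Data.Bool.Base using (Bool; false; T)
open import Data.Bool.Properties using (T-irrelevant; T?)
open import Data.Empty using (⊥-elim)
open import Data.Fin.Base using (Fin; zero; suc; fromℕ; inject₁; combine; finToFun; funToFin)
open import Data.Fin.Properties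
  using (_≟_; any?; <-cmp; combine-injective; finToFun-funToFin)
open import Data.Fin.Subset using (Subset; ∣_∣)
open import Data.List.Base as List using (List; []; _∷_; allFin; cartesianProduct; concatMap)
open import Data.List.Extrema.Nat using (max)
open import Data.List.Membership.Propositional using (_∈_; lose)
open import Data.List.Membership.Propositional.Properties
  using (∈-concatMap⁺; ∈-cartesianProduct⁺; ∈-allFin)
import Data.List.Relation.Unary.All as All
open import Data.List.Relation.Unary.Any as Any using (here)
open import Data.List.Relation.Unary.Any.Properties using (lookup-index)
open import Data.Nat.Base using (ℕ; zero; suc; _+_; _*_; _^_; _≤_; z≤n; s≤s)
open import Data.Product.Base using (∃; ∃-syntax; _×_; _,_; proj₁; proj₂)
open import Data.Sum.Base using (_⊎_; inj₁; inj₂)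
open import Data.Vec.Base using (tabulate)
open import Function.Base using (_∘_)
open import Function.Bundles using (_↔_; _⇔_; Inverse)
open import Function.Definitions using (Injective; Surjective)
open import Relation.Binary.Construct.Closure.Equivalence using (EqClosure)
open import Relation.Binary.Construct.Closure.ReflexiveTransitive using (Star)
open import Relation.Binary.Core using (Rel)
open import Relation.Binary.Definitions using (tri<; tri≈; tri>)
open import Relation.Binary.PropositionalEquality
  using (_≡_; _≢_; refl; sym; trans; cong; subst)
open import Relation.Nullary using (¬_; Dec; yes; no)
open import Relation.Nullary.Decidable using (map′; _×-dec_; _⊎-dec_; _→-dec_; ¬?)
open import Level using (0ℓ)

record Graph : Set where
  field
    order      : ℕ
    adj        : Fin order → Fin order → Bool
    adj-sym    : ∀ u v → adj u v ≡ adj v u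
    adj-irrefl : ∀ v → adj v v ≡ false

  Vertex : Set
  Vertex = Fin order

  Adj : Rel Vertex 0ℓ
  Adj u v = T (adj u v)

  neighbours : Vertex → Subset order
  neighbours v = tabulate (adj v)

  degree : Vertex → ℕ
  degree v = ∣ neighbours v ∣

  -- An edge together with a direction: the edge uv is represented by the
  -- two darts u→v and v→u, exchanged by `rev`.
  record Dart : Set where
    constructor dart
    field
      src tgt  : Vertex
      adjacent : Adj src tgt

  open Dart public

  rev : Dart → Dart
  rev d = dart (tgt d) (src d) (subst T (adj-sym (src d) (tgt d)) (adjacent d))

  SameEdge : Rel Dart 0ℓ
  SameEdge d e = e ≡ d ⊎ e ≡ rev d

  _EndOf_ : Vertex → Dart → Set
  v EndOf d = v ≡ src d ⊎ v ≡ tgt d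

Δ : Graph → ℕ
Δ G = max 0 (List.map (Graph.degree G) (allFin (Graph.order G)))

-- A cycle with 3 + m vertices (and as many edges).
record Cycle (G : Graph) (m : ℕ) : Set where
  open Graph G
  field
    vertex    : Fin (3 + m) → Vertex
    injective : Injective _≡_ _≡_ vertex
    step      : ∀ i → Adj (vertex (inject₁ i)) (vertex (suc i))
    close     : Adj (vertex (fromℕ (2 + m))) (vertex zero)

-- The girth of G is at least g; a graph without cycles has infinite girth.
_≤girth_ : ℕ → Graph → Set
g ≤girth G = ∀ m → Cycle G m → g ≤ 3 + m

-- The equivalence relation R has exactly k classes.
_HasClasses_ : {A : Set} → Rel A 0ℓ → ℕ → Set
_HasClasses_ {A} R k =
  ∃[ class ] (∀ x y → R x y ⇔ class x ≡ class y) × Surjective {A = A} {B = Fin k} _≡_ _≡_ class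

-- For a permutation f of a finite set, this is the relation of lying on the
-- same cycle of f.
SameOrbit : {A : Set} → (A → A) → Rel A 0ℓ
SameOrbit f = EqClosure (λ x y → f x ≡ y)

module _ (G : Graph) where
  open Graph G

  -- A cyclic order on the darts leaving each vertex, as in a drawing.
  record RotationSystem : Set where
    field
      rotation : Dart ↔ Dart

    rotate : Dart → Dart
    rotate = Inverse.to rotation

    field
      rotate-src : ∀ d → src (rotate d) ≡ src d
      cyclic     : ∀ d e → src d ≡ src e → SameOrbit rotate d e

    SameFace : Rel Dart 0ℓ
    SameFace = SameOrbit (rotate ∘ rev)

  SameSource : Rel Dart 0ℓ
  SameSource d e = src d ≡ src e

  SameComponent : Rel Dart 0ℓ
  SameComponent d e = Star Adj (src d) (src e)

  -- Genus 0 means that V − E + F = 2 on each connected component.  The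
  -- Euler genus of a component is never negative, so it suffices to require
  -- the sum over the components, V + F = E + 2C.  All four numbers count
  -- classes of darts: isolated vertices carry no darts and are irrelevant to
  -- planarity.
  GenusZero : RotationSystem → Set
  GenusZero ρ = ∃[ V ] ∃[ E ] ∃[ F ] ∃[ C ]
      SameSource HasClasses V
    × SameEdge HasClasses E
    × RotationSystem.SameFace ρ HasClasses F
    × SameComponent HasClasses C
    × V + F ≡ E + 2 * C

  -- By the Heffter–Edmonds correspondence, embeddings of a connected graph in
  -- the sphere are, up to homeomorphism, its rotation systems of genus 0.
  Planar : Set
  Planar = ∃[ ρ ] GenusZero ρ

  -- The edges share an endpoint, or an edge joins an endpoint of one to an
  -- endpoint of the other.
  Near : Rel Dart 0ℓ
  Near d e = ∃[ u ] ∃[ v ] u EndOf d × v EndOf e × (u ≡ v ⊎ Adj u v)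

  -- A colouring of the edges is a colouring of the darts that does not depend
  -- on the direction.
  IsStrongEdgeColouring : ∀ {k} → (Dart → Fin k) → Set
  IsStrongEdgeColouring colour =
      (∀ d → colour (rev d) ≡ colour d)
    × (∀ d e → ¬ SameEdge d e → Near d e → colour d ≢ colour e)

  StrongEdgeColourable : ℕ → Set
  StrongEdgeColourable k = ∃[ colour ] IsStrongEdgeColouring {k} colour

IsLeast : (ℕ → Set) → ℕ → Set
IsLeast P k = P k × (∀ j → P j → k ≤ j)

least : {P : ℕ → Set} → (∀ k → Dec (P k)) → ∀ b → P b → ∃ (IsLeast P)
least P? zero    p0 = 0 , p0 , λ _ _ → z≤n
least {P} P? (suc b) pb with P? 0
... | yes p0 = 0 , p0 , λ _ _ → z≤n
... | no ¬p0 with least (P? ∘ suc) b pb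
...   | k , pk , min = suc k , pk , min′
  where
  min′ : ∀ j → P j → suc k ≤ j
  min′ zero    p = ⊥-elim (¬p0 p)
  min′ (suc j) p = s≤s (min j p)

module _ (G : Graph) where
  open Graph G

  dart-≡ : ∀ {d e : Dart} → src d ≡ src e → tgt d ≡ tgt e → d ≡ e
  dart-≡ {dart u v p} {dart _ _ q} refl refl = cong (dart u v) (T-irrelevant p q)

  _≟ᵈ_ : (d e : Dart) → Dec (d ≡ e)
  d ≟ᵈ e = map′ (λ (p , q) → dart-≡ p q) (λ { refl → refl , refl })
                (src d ≟ src e ×-dec tgt d ≟ tgt e)

  dartsBetween : Vertex × Vertex → List Dart
  dartsBetween (u , v) with T? (adj u v)
  ... | yes uv = dart u v uv ∷ []
  ... | no  _  = []

  darts : List Dart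
  darts = concatMap dartsBetween (cartesianProduct (allFin order) (allFin order))

  ∈-dartsBetween : ∀ d → d ∈ dartsBetween (src d , tgt d)
  ∈-dartsBetween (dart u v uv) with T? (adj u v)
  ... | yes _  = here (dart-≡ refl refl)
  ... | no ¬uv = ⊥-elim (¬uv uv)

  ∈-darts : ∀ d → d ∈ darts
  ∈-darts d = ∈-concatMap⁺ dartsBetween
    (lose (∈-cartesianProduct⁺ (∈-allFin (src d)) (∈-allFin (tgt d))) (∈-dartsBetween d))

  allDarts? : {P : Dart → Set} → (∀ d → Dec (P d)) → Dec (∀ d → P d)
  allDarts? P? = map′ (λ ps d → All.lookup ps (∈-darts d)) (λ p → All.tabulate (λ {d} _ → p d))
                      (All.all? P? darts)

  sameEdge? : ∀ d e → Dec (SameEdge d e)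
  sameEdge? d e = (e ≟ᵈ d) ⊎-dec (e ≟ᵈ rev d)

  endOf? : ∀ v d → Dec (v EndOf d)
  endOf? v d = (v ≟ src d) ⊎-dec (v ≟ tgt d)

  near? : ∀ d e → Dec (Near G d e)
  near? d e = any? λ u → any? λ v →
    endOf? u d ×-dec endOf? v e ×-dec (u ≟ v ⊎-dec T? (adj u v))

  isStrongEdgeColouring? : ∀ {k} (c : Dart → Fin k) → Dec (IsStrongEdgeColouring G c)
  isStrongEdgeColouring? c =
    allDarts? (λ d → c (rev d) ≟ c d) ×-dec
    allDarts? (λ d → allDarts? λ e →
      ¬? (sameEdge? d e) →-dec near? d e →-dec ¬? (c d ≟ c e))

  strong-resp : ∀ {k} {c c′ : Dart → Fin k} → (∀ d → c d ≡ c′ d) →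
                IsStrongEdgeColouring G c → IsStrongEdgeColouring G c′
  strong-resp eq (s , t) =
    (λ d → trans (sym (eq (rev d))) (trans (s d) (eq d))) ,
    (λ d e ¬same near c≡ → t d e ¬same near (trans (eq d) (trans c≡ (sym (eq e)))))

  strongEdgeColourable? : ∀ k → Dec (StrongEdgeColourable G k)
  strongEdgeColourable? k = map′ from to (any? λ i → isStrongEdgeColouring? (decode i))
    where
    index : Dart → Fin (List.length darts)
    index d = Any.index (∈-darts d)

    decode : Fin (k ^ List.length darts) → Dart → Fin k
    decode i = finToFun i ∘ index

    from : (∃[ i ] IsStrongEdgeColouring G (decode i)) → StrongEdgeColourable G k
    from (i , s) = decode i , s

    to : StrongEdgeColourable G k → ∃[ i ] IsStrongEdgeColouring G (decode i)
    to (c , s) = funToFin c′ , strong-resp agrees s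
      where
      c′ : Fin (List.length darts) → Fin k
      c′ = c ∘ List.lookup darts

      agrees : ∀ d → c d ≡ decode (funToFin c′) d
      agrees d = trans (cong c (lookup-index (∈-darts d)))
                       (sym (finToFun-funToFin c′ (index d)))

  private
    code : (u v : Vertex) → Fin (order * order)
    code u v with <-cmp u v
    ... | tri< _ _ _ = combine u v
    ... | tri≈ _ _ _ = combine u v
    ... | tri> _ _ _ = combine v u

    code-sym : ∀ u v → code v u ≡ code u v
    code-sym u v with <-cmp u v | <-cmp v u
    ... | tri< _ _ _    | tri> _ _ _    = refl
    ... | tri≈ _ refl _ | tri< _ _ _    = refl
    ... | tri≈ _ refl _ | tri≈ _ _ _    = refl
    ... | tri≈ _ refl _ | tri> _ _ _    = refl
    ... | tri> _ _ _    | tri< _ _ _    = refl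
    ... | tri> _ _ _    | tri≈ _ refl _ = refl
    ... | tri< _ _ ¬p   | tri< p _ _    = ⊥-elim (¬p p)
    ... | tri< _ ¬p _   | tri≈ _ p _    = ⊥-elim (¬p (sym p))
    ... | tri> ¬p _ _   | tri> _ _ p    = ⊥-elim (¬p p)

    code-combine : ∀ u v → code u v ≡ combine u v ⊎ code u v ≡ combine v u
    code-combine u v with <-cmp u v
    ... | tri< _ _ _ = inj₁ refl
    ... | tri≈ _ _ _ = inj₁ refl
    ... | tri> _ _ _ = inj₂ refl

    code-sameEdge : ∀ d e → code (src d) (tgt d) ≡ code (src e) (tgt e) → SameEdge d e
    code-sameEdge d e eq
      with code-combine (src d) (tgt d) | code-combine (src e) (tgt e)
    ... | inj₁ p | inj₁ q = let (a , b) = combine-injective _ _ _ _ (trans (sym q) (trans (sym eq) p))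
                            in inj₁ (dart-≡ a b)
    ... | inj₁ p | inj₂ q = let (a , b) = combine-injective _ _ _ _ (trans (sym q) (trans (sym eq) p))
                            in inj₂ (dart-≡ b a)
    ... | inj₂ p | inj₁ q = let (a , b) = combine-injective _ _ _ _ (trans (sym q) (trans (sym eq) p))
                            in inj₂ (dart-≡ a b)
    ... | inj₂ p | inj₂ q = let (a , b) = combine-injective _ _ _ _ (trans (sym q) (trans (sym eq) p))
                            in inj₁ (dart-≡ b a)

  rainbow : StrongEdgeColourable G (order * order)
  rainbow = (λ d → code (src d) (tgt d)) , (λ d → code-sym (src d) (tgt d)) ,
            λ d e ¬same _ eq → ¬same (code-sameEdge d e eq)

  strongChromaticIndex : ∃ (IsLeast (StrongEdgeColourable G))
  strongChromaticIndex = least strongEdgeColourable? (order * order) rainbow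

  χ′ₛ : ℕ
  χ′ₛ = proj₁ strongChromaticIndex

  χ′ₛ-least : IsLeast (StrongEdgeColourable G) χ′ₛ
  χ′ₛ-least = proj₂ strongChromaticIndex

{-# OPTIONS --safe #-}

-- Conflicts only ever need to be counted, so everything is greedy: an edge
-- with at most 3Δ conflicts ("light") can be coloured last.  If some vertex x
-- has, on each edge at x, at most 3Δ conflicts with heavy edges, then a
-- colouring of G − x extends to G: keep the colours of the heavy edges, colour
-- the heavy edges at x, then all the light ones.  If there is no such x, a
-- discharging argument shows that the vertices of degree at least 2 span a
-- subgraph of minimum degree at least 2 and average degree at least 3.
--
-- Planarity and girth at least 6 forbid such a subgraph, by Euler's formula.
-- The inequality E + 2C ≤ V + F is inherited by subgraphs because it survives
-- splitting a single dart off its vertex: this composes both the vertex and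
-- the face permutation with a transposition, so V grows by one, F changes by
-- one, and F grows whenever C does.

module Submission where

open import Defs
open import Data.Bool.Base using (Bool; true; false; T; _∧_; _∨_; not; if_then_else_)
open import Data.Bool.Properties using (T?; T-∧; T-∨; T-≡; ∧-comm)
open import Data.Empty using (⊥; ⊥-elim)
open import Data.Fin.Base as Fin
  using (Fin; zero; suc; toℕ; punchIn; punchOut; combine; remQuot; splitAt)
open import Data.Fin.Properties as Fin
  using (_≟_; any?; all?; injective⇒≤; pigeonhole; ¬∀⟶∃¬; toℕ<n; toℕ-injective; toℕ-inject₁; toℕ-fromℕ;
         punchOut-injective; punchOut-cong; punchOut-punchIn; punchInᵢ≢i;
         combine-injective; combine-remQuot; join-splitAt)
open import Data.Fin.Subset using (∣_∣)
open import Data.List.Base as List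
  using (List; []; _∷_; _++_; length; lookup; allFin; concatMap; filterᵇ; cartesianProduct)
open import Data.List.Extrema.Nat using (xs≤max)
open import Data.List.Membership.Propositional using (_∈_; lose)
open import Data.List.Membership.Propositional.Properties
  using (∈-lookup; ∈-map⁺; ∈-map⁻; ∈-++⁺ˡ; ∈-++⁺ʳ; ∈-++⁻; ∈-concatMap⁺; ∈-filter⁺; ∈-filter⁻;
         ∈-allFin; ∈-cartesianProduct⁺; ∈-deduplicate⁺)
import Data.List.Properties as List
import Data.List.Relation.Unary.All as All
open import Data.List.Relation.Unary.AllPairs using ([]; _∷_)
open import Data.List.Relation.Unary.Any as Any using (here; there)
open import Data.List.Relation.Unary.Any.Properties using (lookup-index)
open import Data.List.Relation.Unary.Unique.DecPropositional.Properties using (deduplicate-!)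
open import Data.List.Relation.Unary.Unique.Propositional using (Unique)
import Data.List.Relation.Unary.Unique.Propositional.Properties as Unique
open import Data.Nat.Base
open import Data.Nat.Properties renaming (_≟_ to _≟ℕ_)
open import Data.Nat.Tactic.RingSolver using (solve-∀)
open import Data.Product.Base using (∃; ∃-syntax; ∃₂; _×_; _,_; proj₁; proj₂; uncurry)
open import Data.Sum.Base as Sum using (_⊎_; inj₁; inj₂; [_,_]′)
open import Data.Sum.Properties using (inj₁-injective; inj₂-injective)
open import Data.Unit.Base using (tt)
import Data.Vec.Base as Vec
open import Function.Base using (_∘_; id; const)
open import Function.Bundles using (Equivalence; Inverse; _⇔_; mk⇔)
open import Function.Definitions using (Injective)
open import Level using (0ℓ)
open import Relation.Binary.Construct.Closure.Equivalence as Eq using (EqClosure)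
open import Relation.Binary.Construct.Closure.ReflexiveTransitive as Star using (Star; ε; _◅_; _◅◅_)
import Relation.Binary.Construct.On as On
open import Relation.Binary.Core using (Rel; _⇒_)
open import Relation.Binary.Definitions using (DecidableEquality; tri<; tri≈; tri>)
open import Relation.Binary.PropositionalEquality
import Relation.Binary.PropositionalEquality.Properties as ≡
open import Relation.Binary.Structures using (IsEquivalence)
open import Relation.Nullary using (¬_; Dec; yes; no; does)
open import Relation.Nullary.Decidable using (map′; _×-dec_; _⊎-dec_; ¬?)

open import Algebra.Properties.CommutativeMonoid.Sum +-0-commutativeMonoid
  using (sum; sum-syntax; ∑-distrib-+; ∑-comm; sum-cong-≗)
open import Algebra.Properties.Semiring.Sum +-*-semiring using (*-distribˡ-sum; *-distribʳ-sum)

open Equivalence using (to; from)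

-- Greedy colouring

-- The average degree 3 is forced by girth 6: if every face has at least six darts, Euler's formula
-- gives `nH + 6 ≤ 3 * vH`, where `nH` counts darts and `vH` vertices. Leaves must go because a
-- facial walk turns back at a leaf, and so may be short without containing a cycle. With minimum
-- degree 2 it never turns back, and a closed walk of length 3, 4 or 5 that never turns back is a
-- cycle.
--
-- A 2-vertex is short of charge, so somebody must pay. The constant `2 * D + 3` in `giver` is
-- chosen so that an edge from a 2-vertex to a non-giver is light; the edge that prevents a
-- reduction at a 2-vertex therefore always leads to a giver.
--
-- In passing to a subgraph no edge is deleted. Both darts of an unwanted edge are split off
-- instead, which leaves a component with two vertices, one edge and one face; it adds 3 to each
-- side of `E + 2 * C ≤ V + F`. So the set of darts, `rev` and `E` stay fixed, and a single
-- permutation varies.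

⟦_⟧ : Bool → ℕ
⟦ true ⟧  = 1
⟦ false ⟧ = 0

⟦⟧-mono : ∀ {b c} → (T b → T c) → ⟦ b ⟧ ≤ ⟦ c ⟧
⟦⟧-mono {false} _ = z≤n
⟦⟧-mono {true} {true} _ = ≤-refl
⟦⟧-mono {true} {false} f = ⊥-elim (f tt)

⟦⟧-true : ∀ {b} → T b → ⟦ b ⟧ ≡ 1
⟦⟧-true {true} _ = refl

⟦⟧-false : ∀ {b} → ¬ T b → ⟦ b ⟧ ≡ 0
⟦⟧-false {true}  ¬b = ⊥-elim (¬b tt)
⟦⟧-false {false} _  = refl

sum-mono : ∀ {n} {f g : Fin n → ℕ} → (∀ i → f i ≤ g i) → sum f ≤ sum g
sum-mono {zero}  _  = z≤n
sum-mono {suc n} le = +-mono-≤ (le zero) (sum-mono (le ∘ suc))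

term≤sum : ∀ {n} (f : Fin n → ℕ) i → f i ≤ sum f
term≤sum f zero    = m≤m+n _ _
term≤sum f (suc i) = ≤-trans (term≤sum (f ∘ suc) i) (m≤n+m _ _)

sum-mono-< : ∀ {n} {f g : Fin n → ℕ} → (∀ i → f i ≤ g i) → ∀ i → f i < g i → sum f < sum g
sum-mono-< le zero    lt = +-mono-<-≤ lt (sum-mono (le ∘ suc))
sum-mono-< le (suc i) lt = +-mono-≤-< (le zero) (sum-mono-< (le ∘ suc) i lt)

sum-zero : ∀ {n} {f : Fin n → ℕ} → (∀ i → f i ≡ 0) → sum f ≡ 0
sum-zero {zero}  _ = refl
sum-zero {suc n} e = cong₂ _+_ (e zero) (sum-zero (e ∘ suc))

sum-indicator : ∀ {n} (v : Fin n) (f : Fin n → ℕ) → ∑[ s < n ] (⟦ does (s ≟ v) ⟧ * f s) ≡ f v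
sum-indicator {suc n} zero f =
  trans (cong₂ _+_ (*-identityˡ (f zero)) (sum-zero {n} {λ _ → 0} λ _ → refl)) (+-identityʳ _)
sum-indicator (suc v) f = trans (sum-cong-≗ λ s → cong (λ b → ⟦ b ⟧ * f (suc s)) (does-suc s))
                                    (sum-indicator v (f ∘ suc))
  where
  does-suc : ∀ s → does (suc s ≟ suc v) ≡ does (s ≟ v)
  does-suc s with s ≟ v
  ... | yes _ = refl
  ... | no  _ = refl

-- Boolean rows and adjacency matrices, with weighted counts

Row : ℕ → Set
Row n = Fin n → Bool

-- An adjacency matrix, used for graphs and edge sets alike. All subgraphs live on the same `Fin n`,
-- so vertices are never renumbered.
Mask : ℕ → Set
Mask n = Fin n → Fin n → Bool

module _ {n : ℕ} where

  count : Row n → ℕ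
  count r = ∑[ s < n ] ⟦ r s ⟧

  weigh : Row n → (Fin n → ℕ) → ℕ
  weigh r f = ∑[ s < n ] (⟦ r s ⟧ * f s)

  deg : Mask n → Fin n → ℕ
  deg h v = count (h v)

  without : Row n → Fin n → Row n
  without r v s = r s ∧ not (does (s ≟ v))

  Symmetric : Mask n → Set
  Symmetric h = ∀ u v → h u v ≡ h v u

  _⊑_ : Mask n → Mask n → Set
  h ⊑ k = ∀ {u v} → T (h u v) → T (k u v)

  flip-T : ∀ {h} → Symmetric h → ∀ {u v} → T (h u v) → T (h v u)
  flip-T sy {u} {v} = subst T (sy u v)

  without⁺ : ∀ {r v s} → T (r s) → s ≢ v → T (without r v s)
  without⁺ {r} {v} {s} p s≢v with r s | s ≟ v
  ... | true | yes e = s≢v e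
  ... | true | no _  = tt

  without⁻ : ∀ {r v s} → T (without r v s) → T (r s) × s ≢ v
  without⁻ {r} {v} {s} p with r s | s ≟ v
  ... | true | no s≢v = tt , s≢v

  weigh-1 : ∀ r → weigh r (const 1) ≡ count r
  weigh-1 r = sum-cong-≗ λ s → *-identityʳ ⟦ r s ⟧

  weigh-without : ∀ {r} v f → T (r v) → weigh r f ≡ f v + weigh (without r v) f
  weigh-without {r} v f p = begin
    weigh r f
      ≡⟨ sum-cong-≗ split ⟩
    ∑[ s < n ] (⟦ does (s ≟ v) ⟧ * f s + ⟦ without r v s ⟧ * f s)
      ≡⟨ ∑-distrib-+ (λ s → ⟦ does (s ≟ v) ⟧ * f s) (λ s → ⟦ without r v s ⟧ * f s) ⟩
    ∑[ s < n ] (⟦ does (s ≟ v) ⟧ * f s) + weigh (without r v) f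
      ≡⟨ cong (_+ weigh (without r v) f) (sum-indicator v f) ⟩
    f v + weigh (without r v) f ∎
    where
    open ≡-Reasoning
    split : ∀ s → ⟦ r s ⟧ * f s ≡ ⟦ does (s ≟ v) ⟧ * f s + ⟦ without r v s ⟧ * f s
    split s with s ≟ v
    split s | no _ with r s
    ... | true  = refl
    ... | false = refl
    split s | yes refl with r s
    ... | true  = sym (+-identityʳ _)

  count-without : ∀ {r} v → T (r v) → count r ≡ suc (count (without r v))
  count-without {r} v p = begin
    count r                              ≡⟨ weigh-1 r ⟨
    weigh r (const 1)                    ≡⟨ weigh-without {r} v (const 1) p ⟩
    suc (weigh (without r v) (const 1))  ≡⟨ cong suc (weigh-1 (without r v)) ⟩
    suc (count (without r v))            ∎
    where open ≡-Reasoning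

  count-none : ∀ {r} → count r ≡ 0 → ∀ v → ¬ T (r v)
  count-none {r} e v p with r v | term≤sum (⟦_⟧ ∘ r) v
  ... | true | le = 1+n≰n (subst (1 ≤_) e le)

  count-some : ∀ {r} → 0 < count r → ∃ λ v → T (r v)
  count-some {r} pos with any? (λ v → T? (r v))
  ... | yes found = found
  ... | no none = ⊥-elim (<-irrefl (sym (sum-zero λ v → ⟦⟧-false (λ p → none (v , p)))) pos)

  count-pos : ∀ {r} v → T (r v) → 0 < count r
  count-pos {r} v p = subst (_≤ count r) (⟦⟧-true p) (term≤sum (⟦_⟧ ∘ r) v)

  weigh-mono : ∀ {r q f g} → (∀ {s} → T (r s) → T (q s)) → (∀ s → f s ≤ g s) → weigh r f ≤ weigh q g
  weigh-mono imp le = sum-mono λ s → *-mono-≤ (⟦⟧-mono imp) (le s)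

  weigh-none : ∀ {r} f → count r ≡ 0 → weigh r f ≡ 0
  weigh-none f e = sum-zero λ s → cong (_* f s) (⟦⟧-false (count-none e s))

  deg-mono : ∀ {h k} → h ⊑ k → ∀ v → deg h v ≤ deg k v
  deg-mono {h} {k} le v = sum-mono {f = λ s → ⟦ h v s ⟧} λ s → ⟦⟧-mono (le {v} {s})

  length-concatMap-filter : ∀ {A : Set} (r : Row n) (g : Fin n → List A) →
    length (concatMap g (filterᵇ r (allFin n))) ≡ weigh r (length ∘ g)
  length-concatMap-filter {A} r g = go n id
    where
    go : ∀ m (ι : Fin m → Fin n) →
         length (concatMap g (filterᵇ r (List.tabulate ι))) ≡ ∑[ s < m ] (⟦ r (ι s) ⟧ * length (g (ι s)))
    go zero    ι = refl
    go (suc m) ι with r (ι zero)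
    ... | false = go m (ι ∘ suc)
    ... | true  = trans (List.length-++ (g (ι zero)))
                        (cong₂ _+_ (sym (+-identityʳ _)) (go m (ι ∘ suc)))

  length-filter : ∀ (r : Row n) → length (filterᵇ r (allFin n)) ≡ count r
  length-filter r = go n id
    where
    go : ∀ m (ι : Fin m → Fin n) → length (filterᵇ r (List.tabulate ι)) ≡ ∑[ s < m ] ⟦ r (ι s) ⟧
    go zero    ι = refl
    go (suc m) ι with r (ι zero)
    ... | false = go m (ι ∘ suc)
    ... | true  = cong suc (go m (ι ∘ suc))

  darting : Row n → Mask n → List (Fin n × Fin n)
  darting r h = concatMap (λ s → List.map (s ,_) (filterᵇ (h s) (allFin n))) (filterᵇ r (allFin n))

  length-darting : ∀ r h → length (darting r h) ≡ weigh r (deg h)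
  length-darting r h = trans (length-concatMap-filter r _)
    (sum-cong-≗ λ s → cong (⟦ r s ⟧ *_)
      (trans (List.length-map (s ,_) (filterᵇ (h s) (allFin n))) (length-filter (h s))))

  ∈-filterᵇ : ∀ {r : Row n} {s} → T (r s) → s ∈ filterᵇ r (allFin n)
  ∈-filterᵇ {r} {s} p = ∈-filter⁺ (T? ∘ r) (∈-allFin s) p

  ∈-darting : ∀ {r h s t} → T (r s) → T (h s t) → (s , t) ∈ darting r h
  ∈-darting {r} {h} {s} p q =
    ∈-concatMap⁺ (λ s → List.map (s ,_) (filterᵇ (h s) (allFin n)))
      (lose (∈-filterᵇ {r = r} p) (∈-map⁺ (s ,_) (∈-filterᵇ {r = h s} q)))

injection-into-list : ∀ {A : Set} {m} {xs : List A} (f : Fin m → A) →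
  Injective _≡_ _≡_ f → (∀ i → f i ∈ xs) → m ≤ length xs
injection-into-list {xs = xs} f f-inj f∈ = injective⇒≤ {f = λ i → Any.index (f∈ i)} λ {i} {j} e →
  f-inj (trans (lookup-index (f∈ i)) (trans (cong (lookup xs) e) (sym (lookup-index (f∈ j)))))

fresh : ∀ {k} (cs : List (Fin k)) → length cs < k → ∃ λ c → ¬ c ∈ cs
fresh {k} cs short = ¬∀⟶∃¬ k (_∈ cs) (λ c → Any.any? (c ≟_) cs)
  λ all → <⇒≱ short (injection-into-list id id all)

-- Extending a strong colouring edge by edge

module Greedy {n k : ℕ} (adj : Mask n) (adj-sym : Symmetric adj) where

  private V = Fin n

  Colouring : Set
  Colouring = V → V → Fin k

  SameEnds : V → V → V → V → Set
  SameEnds u v x y = (x ≡ u × y ≡ v) ⊎ (x ≡ v × y ≡ u)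

  abstract
    sameEnds? : ∀ u v x y → Dec (SameEnds u v x y)
    sameEnds? u v x y = (x ≟ u ×-dec y ≟ v) ⊎-dec (x ≟ v ×-dec y ≟ u)

  Close : V → V → V → V → Set
  Close u v x y = ∃[ a ] ∃[ b ] (a ≡ u ⊎ a ≡ v) × (b ≡ x ⊎ b ≡ y) × (a ≡ b ⊎ T (adj a b))

  record Proper (F : Mask n) (c : Colouring) : Set where
    field
      symmetric : ∀ u v → c u v ≡ c v u
      strong    : ∀ u v x y → T (F u v) → T (F x y) → ¬ SameEnds u v x y → Close u v x y →
                  c u v ≢ c x y

  open Proper

  -- At least one dart of every edge of F in conflict with uv.
  blockers : Mask n → V → V → List (V × V)
  blockers F u v = darting (without (adj u) v) F ++ darting (without (adj v) u) F

  -- For adjacent `u` and `v` this is the sum of `deg F` over the neighbours of `u` and over those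
  -- of `v`, less `deg F u + deg F v`. An edge may be counted by both of its darts, so the number of
  -- conflicts is only bounded from above.
  load : Mask n → V → V → ℕ
  load F u v = weigh (without (adj u) v) (deg F) + weigh (without (adj v) u) (deg F)

  length-blockers : ∀ F u v → length (blockers F u v) ≡ load F u v
  length-blockers F u v = trans (List.length-++ (darting (without (adj u) v) F))
    (cong₂ _+_ (length-darting (without (adj u) v) F) (length-darting (without (adj v) u) F))

  load-mono : ∀ {F F′} → F ⊑ F′ → ∀ u v → load F u v ≤ load F′ u v
  load-mono {F} {F′} le u v =
    +-mono-≤ (weigh-mono {r = without (adj u) v} id (deg-mono {h = F} {F′} le))
             (weigh-mono {r = without (adj v) u} id (deg-mono {h = F} {F′} le))

  -- An edge in conflict with uv has an endpoint s ∉ {u , v} next to u or to v.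
  blocked : ∀ {F} → F ⊑ adj → Symmetric F → ∀ {u v x y} → T (F x y) →
    ¬ SameEnds u v x y → Close u v x y →
    (x , y) ∈ blockers F u v ⊎ (y , x) ∈ blockers F u v
  blocked {F} F⊑adj F-sym {u} {v} {x} {y} xy ¬same (a , b , a∈ , b∈ , ab) = side a∈ b∈
    where
    yx : T (F y x)
    yx = flip-T F-sym xy

    left : ∀ {s t} → T (adj u s) → s ≢ v → T (F s t) → (s , t) ∈ blockers F u v
    left p s≢v q = ∈-++⁺ˡ (∈-darting {r = without (adj u) v} {h = F} (without⁺ {r = adj u} p s≢v) q)

    right : ∀ {s t} → T (adj v s) → s ≢ u → T (F s t) → (s , t) ∈ blockers F u v
    right p s≢u q = ∈-++⁺ʳ (darting (without (adj u) v) F)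
      (∈-darting {r = without (adj v) u} {h = F} (without⁺ {r = adj v} p s≢u) q)

    fromU : ∀ {s t} → ¬ SameEnds u v s t → T (F s t) → u ≡ s ⊎ T (adj u s) →
            (s , t) ∈ blockers F u v ⊎ (t , s) ∈ blockers F u v
    fromU ¬same st (inj₁ refl) =
      inj₂ (left (F⊑adj st) (λ { refl → ¬same (inj₁ (refl , refl)) }) (flip-T F-sym st))
    fromU {s} {t} ¬same st (inj₂ us) with s ≟ v
    ... | no s≢v = inj₁ (left us s≢v st)
    -- The edge starts at `v` itself, so the dart from its other end belongs to the second list.
    ... | yes refl =
      inj₂ (right (F⊑adj st) (λ { refl → ¬same (inj₂ (refl , refl)) }) (flip-T F-sym st))

    fromV : ∀ {s t} → ¬ SameEnds u v s t → T (F s t) → v ≡ s ⊎ T (adj v s) →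
            (s , t) ∈ blockers F u v ⊎ (t , s) ∈ blockers F u v
    fromV ¬same st (inj₁ refl) =
      inj₂ (right (F⊑adj st) (λ { refl → ¬same (inj₂ (refl , refl)) }) (flip-T F-sym st))
    fromV {s} {t} ¬same st (inj₂ vs) with s ≟ u
    ... | no s≢u = inj₁ (right vs s≢u st)
    ... | yes refl =
      inj₂ (left (F⊑adj st) (λ { refl → ¬same (inj₁ (refl , refl)) }) (flip-T F-sym st))

    swapped : ¬ SameEnds u v y x
    swapped (inj₁ (p , q)) = ¬same (inj₂ (q , p))
    swapped (inj₂ (p , q)) = ¬same (inj₁ (q , p))

    swap : ∀ {A B : Set} → A ⊎ B → B ⊎ A
    swap = [ inj₂ , inj₁ ]′

    side : a ≡ u ⊎ a ≡ v → b ≡ x ⊎ b ≡ y → (x , y) ∈ blockers F u v ⊎ (y , x) ∈ blockers F u v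
    side (inj₁ refl) (inj₁ refl) = fromU ¬same xy ab
    side (inj₁ refl) (inj₂ refl) = swap (fromU swapped yx ab)
    side (inj₂ refl) (inj₁ refl) = fromV ¬same xy ab
    side (inj₂ refl) (inj₂ refl) = swap (fromV swapped yx ab)

  insert : Mask n → V → V → Mask n
  insert F u v x y = F x y ∨ does (sameEnds? u v x y)

  insert⁻ : ∀ {F u v x y} → T (insert F u v x y) → T (F x y) ⊎ SameEnds u v x y
  insert⁻ {F} {u} {v} {x} {y} p with F x y | sameEnds? u v x y
  ... | true  | _     = inj₁ tt
  ... | false | yes s = inj₂ s

  insert-⊒ : ∀ {F u v} → F ⊑ insert F u v
  insert-⊒ {F} {u} {v} {x} {y} p with F x y
  ... | true = tt

  insert-self : ∀ {F u v} → T (insert F u v u v)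
  insert-self {F} {u} {v} with F u v | sameEnds? u v u v
  ... | true  | _     = tt
  ... | false | yes _ = tt
  ... | false | no ¬s = ¬s (inj₁ (refl , refl))

  insert-sym : ∀ {F} → Symmetric F → ∀ {u v} → Symmetric (insert F u v)
  insert-sym F-sym {u} {v} x y = cong₂ _∨_ (F-sym x y) same
    where
    same : does (sameEnds? u v x y) ≡ does (sameEnds? u v y x)
    same with sameEnds? u v x y | sameEnds? u v y x
    ... | yes _ | yes _ = refl
    ... | no  _ | no  _ = refl
    ... | yes (inj₁ (p , q)) | no ¬s = ⊥-elim (¬s (inj₂ (q , p)))
    ... | yes (inj₂ (p , q)) | no ¬s = ⊥-elim (¬s (inj₁ (q , p)))
    ... | no ¬s | yes (inj₁ (p , q)) = ⊥-elim (¬s (inj₂ (q , p)))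
    ... | no ¬s | yes (inj₂ (p , q)) = ⊥-elim (¬s (inj₁ (q , p)))

  close-sym : ∀ {u v x y} → Close u v x y → Close x y u v
  close-sym (a , b , a∈ , b∈ , inj₁ e) = b , a , b∈ , a∈ , inj₁ (sym e)
  close-sym (a , b , a∈ , b∈ , inj₂ p) = b , a , b∈ , a∈ , inj₂ (flip-T adj-sym p)

  sameEnds-close : ∀ {u v p q x y} → SameEnds u v p q → Close p q x y → Close u v x y
  sameEnds-close (inj₁ (refl , refl)) cl = cl
  sameEnds-close (inj₂ (refl , refl)) (a , b , a∈ , rest) = a , b , [ inj₂ , inj₁ ]′ a∈ , rest

  sameEnds-trans : ∀ {u v p q x y} → SameEnds u v p q → SameEnds u v x y → SameEnds p q x y
  sameEnds-trans (inj₁ (refl , refl)) s = s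
  sameEnds-trans (inj₂ (refl , refl)) (inj₁ (p , q)) = inj₂ (p , q)
  sameEnds-trans (inj₂ (refl , refl)) (inj₂ (p , q)) = inj₁ (p , q)

  -- The blockers use at most `load F u v` colours, so one is free for `uv`. No other edge changes
  -- colour, hence pairs that avoid `uv` need no new argument.
  extend : ∀ {F c} → F ⊑ adj → Symmetric F → Proper F c → ∀ u v → load F u v < k →
           ∃ λ c′ → Proper (insert F u v) c′
  extend {F} {c} F⊑adj F-sym proper u v few = recolour , record
    { symmetric = recolour-sym
    ; strong    = λ p q x y → recolour-strong {p} {q} {x} {y}
    }
    where
    taken : List (Fin k)
    taken = List.map (λ (x , y) → c x y) (blockers F u v)

    new : ∃ λ col → ¬ col ∈ taken
    new = fresh taken (subst (_< k)
      (sym (trans (List.length-map _ (blockers F u v)) (length-blockers F u v))) few)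

    recolour : Colouring
    recolour x y = if does (sameEnds? u v x y) then proj₁ new else c x y

    recolour-sym : ∀ x y → recolour x y ≡ recolour y x
    recolour-sym x y with sameEnds? u v x y | sameEnds? u v y x
    ... | yes _ | yes _ = refl
    ... | no  _ | no  _ = symmetric proper x y
    ... | yes (inj₁ (p , q)) | no ¬s = ⊥-elim (¬s (inj₂ (q , p)))
    ... | yes (inj₂ (p , q)) | no ¬s = ⊥-elim (¬s (inj₁ (q , p)))
    ... | no ¬s | yes (inj₁ (p , q)) = ⊥-elim (¬s (inj₂ (q , p)))
    ... | no ¬s | yes (inj₂ (p , q)) = ⊥-elim (¬s (inj₁ (q , p)))

    clash : ∀ {x y} → T (F x y) → ¬ SameEnds u v x y → Close u v x y → proj₁ new ≢ c x y
    clash {x} {y} xy ¬same close e with blocked F⊑adj F-sym xy ¬same close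
    ... | inj₁ m = proj₂ new (subst (_∈ taken) (sym e) (∈-map⁺ _ m))
    ... | inj₂ m = proj₂ new (subst (_∈ taken) (sym (trans e (symmetric proper x y))) (∈-map⁺ _ m))

    recolour-strong : ∀ {p q x y} → T (insert F u v p q) → T (insert F u v x y) →
      ¬ SameEnds p q x y → Close p q x y → recolour p q ≢ recolour x y
    recolour-strong {p} {q} {x} {y} pq xy ¬same close
      with sameEnds? u v p q | sameEnds? u v x y | insert⁻ {F} {x = p} {q} pq | insert⁻ {F} {x = x} {y} xy
    ... | yes s | yes t | _ | _ = ⊥-elim (¬same (sameEnds-trans s t))
    ... | yes s | no ¬t | _ | inj₁ f = clash f ¬t (sameEnds-close s close)
    ... | yes s | no ¬t | _ | inj₂ t = ⊥-elim (¬t t)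
    ... | no ¬s | yes t | inj₁ f | _ = clash f ¬s (sameEnds-close t (close-sym close)) ∘ sym
    ... | no ¬s | yes t | inj₂ s | _ = ⊥-elim (¬s s)
    ... | no ¬s | no ¬t | inj₁ f | inj₁ g = strong proper p q x y f g ¬same close
    ... | no ¬s | no ¬t | inj₂ s | _ = ⊥-elim (¬s s)
    ... | no ¬s | no ¬t | _ | inj₂ t = ⊥-elim (¬t t)

  proper-⊑ : ∀ {F F′ c} → F ⊑ F′ → Proper F′ c → Proper F c
  proper-⊑ le proper = record
    { symmetric = symmetric proper
    ; strong    = λ u v x y p q → strong proper u v x y (le p) (le q)
    }

  -- The bound is required for `F₁` only: all intermediate masks lie inside `F₁`, so by `load-mono`
  -- the edges can be inserted in any order.
  extendTo : ∀ {F₀ F₁ c} → F₀ ⊑ F₁ → F₁ ⊑ adj → Symmetric F₀ → Symmetric F₁ → Proper F₀ c →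
             (∀ {u v} → T (F₁ u v) → ¬ T (F₀ u v) → load F₁ u v < k) →
             ∃ λ c′ → Proper F₁ c′
  extendTo {F₀} {F₁} F₀⊑F₁ F₁⊑adj sym₀ sym₁ proper₀ few
    with go (cartesianProduct (allFin n) (allFin n))
    where
    go : (es : List (V × V)) →
         ∃[ F ] ∃[ c ] F₀ ⊑ F × F ⊑ F₁ × Symmetric F × Proper F c ×
           (∀ {u v} → (u , v) ∈ es → T (F₁ u v) → T (F u v))
    go [] = F₀ , _ , id , F₀⊑F₁ , sym₀ , proper₀ , λ ()
    go ((u , v) ∷ es) with go es
    ... | F , c , lo , hi , F-sym , proper , done with T? (F u v) | T? (F₁ u v)
    ... | yes uv∈F | _ = F , c , lo , hi , F-sym , proper ,
            λ { (here refl) _ → uv∈F ; (there m) → done m }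
    ... | no _     | no uv∉ = F , c , lo , hi , F-sym , proper ,
            λ { (here refl) uv → ⊥-elim (uv∉ uv) ; (there m) → done m }
    ... | no uv∉F  | yes uv =
      let c′ , proper′ = extend (F₁⊑adj ∘ hi) F-sym proper u v
                           (≤-<-trans (load-mono {F} {F₁} hi u v) (few uv (uv∉F ∘ lo)))
      in insert F u v , c′ , (λ p → insert-⊒ {F} (lo p)) , within , insert-sym F-sym , proper′ ,
         λ { (here refl) _ → insert-self {F} ; (there m) p → insert-⊒ {F} (done m p) }
      where
      within : insert F u v ⊑ F₁
      within {x} {y} p with insert⁻ {F} {x = x} {y} p
      ... | inj₁ f = hi f
      ... | inj₂ (inj₁ (refl , refl)) = uv
      ... | inj₂ (inj₂ (refl , refl)) = flip-T sym₁ uv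
  ... | F , c , _ , _ , _ , proper , done =
    c , proper-⊑ (λ {u} {v} → done (∈-cartesianProduct⁺ (∈-allFin u) (∈-allFin v))) proper

-- Discharging

sum-some : ∀ {n} {f : Fin n → ℕ} → 0 < sum f → ∃ λ i → 0 < f i
sum-some {f = f} pos with any? (λ i → 0 <? f i)
... | yes found = found
... | no none = ⊥-elim (<-irrefl (sym (sum-zero λ i → n≤0⇒n≡0 (≮⇒≥ λ p → none (i , p)))) pos)

∧⁺ : ∀ {b c} → T b → T c → T (b ∧ c)
∧⁺ p q = Equivalence.from T-∧ (p , q)

∧⁻ : ∀ {b c} → T (b ∧ c) → T b × T c
∧⁻ = Equivalence.to T-∧

module _ {n : ℕ} {r : Row n} where

  weigh-const : ∀ c → weigh r (const c) ≡ count r * c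
  weigh-const c = sym (*-distribʳ-sum c (⟦_⟧ ∘ r))

  weigh-single : count r ≡ 1 → ∀ {v} → T (r v) → ∀ f → weigh r f ≡ f v
  weigh-single one {v} p f = begin
    weigh r f                      ≡⟨ weigh-without {r = r} v f p ⟩
    f v + weigh (without r v) f    ≡⟨ cong (f v +_) (weigh-none {r = without r v} f
                                        (suc-injective (trans (sym (count-without {r = r} v p)) one))) ⟩
    f v + 0                        ≡⟨ +-identityʳ (f v) ⟩
    f v                            ∎
    where open ≡-Reasoning

  single-unique : count r ≡ 1 → ∀ {v w} → T (r v) → T (r w) → w ≡ v
  single-unique one {v} {w} p q with w ≟ v
  ... | yes e = e
  ... | no w≢v = ⊥-elim (count-none {r = without r v}
                   (suc-injective (trans (sym (count-without {r = r} v p)) one)) w (without⁺ {r = r} q w≢v))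

record Pair {n} (r : Row n) (v : Fin n) : Set where
  field
    other      : Fin n
    other∈     : T (r other)
    weigh-pair : ∀ f → weigh r f ≡ f v + f other
    exhaustive : ∀ {y} → T (r y) → y ≡ v ⊎ y ≡ other

pair : ∀ {n} {r : Row n} → count r ≡ 2 → ∀ {v} → T (r v) → Pair r v
pair {n} {r} two {v} p = record
  { other      = w
  ; other∈     = proj₁ (without⁻ {r = r} (proj₂ found))
  ; weigh-pair = λ f → trans (weigh-without {r = r} v f p)
                             (cong (f v +_) (weigh-single {r = without r v} one (proj₂ found) f))
  ; exhaustive = λ {y} → exhaust y
  }
  where
  one : count (without r v) ≡ 1
  one = suc-injective (trans (sym (count-without {r = r} v p)) two)

  found : ∃ λ w → T (without r v w)
  found = count-some {r = without r v} (subst (0 <_) (sym one) z<s)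

  w = proj₁ found

  exhaust : ∀ y → T (r y) → y ≡ v ⊎ y ≡ w
  exhaust y q with y ≟ v
  ... | yes e  = inj₁ e
  ... | no y≢v = inj₂ (single-unique {r = without r v} one (proj₂ found) (without⁺ {r = r} q y≢v))

data Size (k : ℕ) : Set where
  is0 : k ≡ 0 → Size k
  is1 : k ≡ 1 → Size k
  is2 : k ≡ 2 → Size k
  is3+ : 3 ≤ k → Size k

size : ∀ k → Size k
size 0 = is0 refl
size 1 = is1 refl
size 2 = is2 refl
size (suc (suc (suc _))) = is3+ (s≤s (s≤s (s≤s z≤n)))

data Kind : Set where
  none leaf weak plain big : Kind

value : (α β γ δ : ℕ) → Kind → ℕ
value α β γ δ none  = 0
value α β γ δ leaf  = α
value α β γ δ weak  = β
value α β γ δ plain = γ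
value α β γ δ big   = δ

module Discharging {n : ℕ} (adj : Mask n) (adj-sym : Symmetric adj)
                   (D : ℕ) (deg≤D : ∀ v → deg adj v ≤ D) where

  V = Fin n

  d S : V → ℕ
  d = deg adj
  S v = weigh (adj v) d

  -- The edge uv is in conflict with at most S u + S v − (d u + d v) edges.
  heavy : Mask n
  heavy u v = adj u v ∧ (3 * D + (d u + d v) <ᵇ S u + S v)

  hd Sh : V → ℕ
  hd = deg heavy
  Sh v = weigh (adj v) hd

  -- More than 3D darts are counted when only conflicts with heavy edges matter.
  Demanding : V → V → Set
  Demanding u v = T (adj u v) × 3 * D + (hd u + hd v) < Sh u + Sh v

  -- A non-isolated vertex that violates this is what `recolour` needs to put its edges back.
  Irreducible : Set
  Irreducible = ∀ x → 0 < d x → ∃ λ y → Demanding x y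

  -- Charge is counted in half units.  A vertex with k neighbours that are not
  -- leaves starts with 2k − 6, and a giver pays 2 to each weak and 1 to each
  -- plain neighbour: a 2-vertex is weak when at most one neighbour is a giver.
  p : V → ℕ
  p v = ∑[ y < n ] ⟦ adj v y ∧ (3 ≤ᵇ d y) ⟧

  -- A vertex that fails the second clause has only light edges to vertices of degree at most 2
  -- (`path-light`, `leaf-light`). If it fails the first as well, at most two of its edges are heavy
  -- (`hd-not-giver`).
  giver : V → Bool
  giver v = (3 ≤ᵇ p v) ∨ (2 * D + 3 ≤ᵇ S v)

  g : V → ℕ
  g u = weigh (adj u) (⟦_⟧ ∘ giver)

  classify : ℕ → ℕ → Kind
  classify 0 _ = none
  classify 1 _ = leaf
  classify 2 k = if k ≤ᵇ 1 then weak else plain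
  classify (suc (suc (suc _))) _ = big

  kind : V → V → Kind
  kind v y = if adj v y then classify (d y) (g y) else none

  -- Each estimate of a sum over neighbours is one choice of the four coefficients; `total-linear`
  -- then expresses it by the numbers `ℓ`, `a`, `m`, `b` of leaf, weak, plain and big neighbours.
  total : (α β γ δ : ℕ) → V → ℕ
  total α β γ δ v = ∑[ y < n ] value α β γ δ (kind v y)

  ℓ a m b : V → ℕ
  ℓ = total 1 0 0 0
  a = total 0 1 0 0
  m = total 0 0 1 0
  b = total 0 0 0 1

  total-linear : ∀ α β γ δ v → total α β γ δ v ≡ (α * ℓ v + β * a v) + (γ * m v + δ * b v)
  total-linear α β γ δ v = begin
    total α β γ δ v
      ≡⟨ sum-cong-≗ (λ y → split (kind v y)) ⟩
    ∑[ y < n ] ((α * L y + β * A y) + (γ * M y + δ * B y))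
      ≡⟨ ∑-distrib-+ (λ y → α * L y + β * A y) (λ y → γ * M y + δ * B y) ⟩
    ∑[ y < n ] (α * L y + β * A y) + ∑[ y < n ] (γ * M y + δ * B y)
      ≡⟨ cong₂ _+_ (∑-distrib-+ (λ y → α * L y) (λ y → β * A y))
                   (∑-distrib-+ (λ y → γ * M y) (λ y → δ * B y)) ⟩
    (∑[ y < n ] (α * L y) + ∑[ y < n ] (β * A y)) + (∑[ y < n ] (γ * M y) + ∑[ y < n ] (δ * B y))
      ≡⟨ cong₂ _+_ (cong₂ _+_ (*-distribˡ-sum α L) (*-distribˡ-sum β A))
                   (cong₂ _+_ (*-distribˡ-sum γ M) (*-distribˡ-sum δ B)) ⟨
    (α * ℓ v + β * a v) + (γ * m v + δ * b v) ∎
    where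
    open ≡-Reasoning
    L A M B : V → ℕ
    L y = value 1 0 0 0 (kind v y)
    A y = value 0 1 0 0 (kind v y)
    M y = value 0 0 1 0 (kind v y)
    B y = value 0 0 0 1 (kind v y)
    split : ∀ k → value α β γ δ k ≡ (α * value 1 0 0 0 k + β * value 0 1 0 0 k)
                                  + (γ * value 0 0 1 0 k + δ * value 0 0 0 1 k)
    split none  = zeros α β γ δ
      where
      zeros : ∀ α β γ δ → 0 ≡ (α * 0 + β * 0) + (γ * 0 + δ * 0)
      zeros = solve-∀
    split leaf  = only α β γ δ
      where
      only : ∀ α β γ δ → α ≡ (α * 1 + β * 0) + (γ * 0 + δ * 0)
      only = solve-∀
    split weak  = only α β γ δ
      where
      only : ∀ α β γ δ → β ≡ (α * 0 + β * 1) + (γ * 0 + δ * 0)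
      only = solve-∀
    split plain = only α β γ δ
      where
      only : ∀ α β γ δ → γ ≡ (α * 0 + β * 0) + (γ * 1 + δ * 0)
      only = solve-∀
    split big   = only α β γ δ
      where
      only : ∀ α β γ δ → δ ≡ (α * 0 + β * 0) + (γ * 0 + δ * 1)
      only = solve-∀

  adj-flip : ∀ {u v} → T (adj u v) → T (adj v u)
  adj-flip = flip-T {h = adj} adj-sym

  d-pos : ∀ {u v} → T (adj u v) → 0 < d v
  d-pos {u} {v} uv = count-pos {r = adj v} u (adj-flip uv)

  heavy-sym : Symmetric heavy
  heavy-sym u v = cong₂ _∧_ (adj-sym u v)
    (cong₂ (λ x y → 3 * D + x <ᵇ y) (+-comm (d u) (d v)) (+-comm (S u) (S v)))

  heavy⊑adj : heavy ⊑ adj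
  heavy⊑adj h = proj₁ (∧⁻ h)

  hd≤d : ∀ v → hd v ≤ d v
  hd≤d = deg-mono {h = heavy} {adj} (λ {u} {v} → heavy⊑adj {u} {v})

  light : ∀ {u v} → S u + S v ≤ 3 * D + (d u + d v) → ¬ T (heavy u v)
  light {u} {v} le h = ≤⇒≯ le (<ᵇ⇒< _ _ (proj₂ (∧⁻ {adj u v} h)))

  light-bound : ∀ {u v} → T (adj u v) → ¬ T (heavy u v) → S u + S v ≤ 3 * D + (d u + d v)
  light-bound uv ¬h = ≮⇒≥ λ lt → ¬h (∧⁺ uv (<⇒<ᵇ lt))

  -- This compares the sums over the neighbours of `u` other than `v`, where `hd ≤ d` holds term by
  -- term. The terms of `v` are moved across to avoid subtraction.
  Sh-S : ∀ {u v} → T (adj u v) → Sh u + d v ≤ S u + hd v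
  Sh-S {u} {v} uv = begin
    Sh u + d v
      ≡⟨ cong (_+ d v) (weigh-without {r = adj u} v hd uv) ⟩
    hd v + weigh (without (adj u) v) hd + d v
      ≤⟨ +-monoˡ-≤ (d v) (+-monoʳ-≤ (hd v) (weigh-mono {r = without (adj u) v} id hd≤d)) ⟩
    hd v + weigh (without (adj u) v) d + d v
      ≡⟨ rotate (hd v) (weigh (without (adj u) v) d) (d v) ⟩
    d v + weigh (without (adj u) v) d + hd v
      ≡⟨ cong (_+ hd v) (weigh-without {r = adj u} v d uv) ⟨
    S u + hd v ∎
    where
    open ≤-Reasoning
    rotate : ∀ x y z → x + y + z ≡ z + y + x
    rotate = solve-∀

  -- Conflicts with heavy edges are among all conflicts; `Sh-S`, used at both ends, is this fact in
  -- terms of degrees.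
  demanding⇒heavy : ∀ {u v} → Demanding u v → T (heavy u v)
  demanding⇒heavy {u} {v} (uv , lt) with T? (heavy u v)
  ... | yes h = h
  ... | no ¬h = ⊥-elim (<⇒≱ lt (+-cancelʳ-≤ (d u + d v) _ _ bound))
    where
    open ≤-Reasoning
    swap₁ : ∀ x y z w → x + y + (z + w) ≡ (x + w) + (y + z)
    swap₁ = solve-∀
    swap₂ : ∀ x y z w → (x + y) + (z + w) ≡ (x + z) + (w + y)
    swap₂ = solve-∀
    swap₃ : ∀ x y z → x + y + z ≡ x + z + y
    swap₃ = solve-∀
    bound : Sh u + Sh v + (d u + d v) ≤ 3 * D + (hd u + hd v) + (d u + d v)
    bound = begin
      Sh u + Sh v + (d u + d v)          ≡⟨ swap₁ (Sh u) (Sh v) (d u) (d v) ⟩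
      (Sh u + d v) + (Sh v + d u)        ≤⟨ +-mono-≤ (Sh-S uv) (Sh-S (adj-flip uv)) ⟩
      (S u + hd v) + (S v + hd u)        ≡⟨ swap₂ (S u) (hd v) (S v) (hd u) ⟩
      (S u + S v) + (hd u + hd v)        ≤⟨ +-monoˡ-≤ (hd u + hd v) (light-bound uv ¬h) ⟩
      3 * D + (d u + d v) + (hd u + hd v) ≡⟨ swap₃ (3 * D) (d u + d v) (hd u + hd v) ⟩
      3 * D + (hd u + hd v) + (d u + d v) ∎

  not-giver : ∀ {w} → ¬ T (giver w) → p w ≤ 2 × S w ≤ 2 * D + 2
  not-giver {w} ¬g =
      ≤-pred (≰⇒> λ le → ¬g (Equivalence.from T-∨ (inj₁ (≤⇒≤ᵇ le))))
    , ≤-pred (subst (S w <_) (+-suc (2 * D) 2)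
        (≰⇒> λ le → ¬g (Equivalence.from (T-∨ {3 ≤ᵇ p w}) (inj₂ (≤⇒≤ᵇ le)))))

  -- The only neighbour of `u` besides `w` adds at most `D`, so `S u ≤ d w + D`. With
  -- `S w ≤ 2 * D + 2` the bound for light edges is met with nothing to spare.
  path-light : ∀ {u w} → d u ≡ 2 → T (adj u w) → ¬ T (giver w) → ¬ T (heavy u w)
  path-light {u} {w} two uw ¬g = light {u} {w} (begin
    S u + S w                   ≡⟨ cong (_+ S w) (weigh-pair d) ⟩
    d w + d other + S w         ≤⟨ +-mono-≤ (+-monoʳ-≤ (d w) (deg≤D other)) (proj₂ (not-giver ¬g)) ⟩
    d w + D + (2 * D + 2)       ≡⟨ shuffle (d w) D ⟩
    3 * D + (2 + d w)           ≡⟨ cong (λ k → 3 * D + (k + d w)) two ⟨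
    3 * D + (d u + d w)         ∎)
    where
    open ≤-Reasoning
    open Pair (pair {r = adj u} two uw)
    shuffle : ∀ x D → x + D + (2 * D + 2) ≡ 3 * D + (2 + x)
    shuffle = solve-∀

  leaf-light : ∀ {u w} → d u ≡ 1 → T (adj u w) → ¬ T (giver w) → ¬ T (heavy u w)
  leaf-light {u} {w} one uw ¬g = light {u} {w} (begin
    S u + S w                   ≡⟨ cong (_+ S w) (weigh-single {r = adj u} one uw d) ⟩
    d w + S w                   ≤⟨ +-monoʳ-≤ (d w) (proj₂ (not-giver ¬g)) ⟩
    d w + (2 * D + 2)           ≡⟨ shuffle (d w) D ⟩
    2 * D + 1 + (1 + d w)       ≤⟨ +-monoˡ-≤ (1 + d w) (+-monoʳ-≤ (2 * D) (≤-trans (d-pos uw) (deg≤D w))) ⟩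
    2 * D + D + (1 + d w)       ≡⟨ three D (d w) ⟩
    3 * D + (1 + d w)           ≡⟨ cong (λ k → 3 * D + (k + d w)) one ⟨
    3 * D + (d u + d w)         ∎)
    where
    open ≤-Reasoning
    shuffle : ∀ x D → x + (2 * D + 2) ≡ 2 * D + 1 + (1 + x)
    shuffle = solve-∀
    three : ∀ D x → 2 * D + D + (1 + x) ≡ 3 * D + (1 + x)
    three = solve-∀

  -- Edges from `w` to vertices of degree at most 2 are light, so the heavy ones are among the at
  -- most two that lead to vertices of degree at least 3.
  hd-not-giver : ∀ {w} → ¬ T (giver w) → hd w ≤ 2
  hd-not-giver {w} ¬g = ≤-trans (sum-mono λ y → ⟦⟧-mono (to-big y)) (proj₁ (not-giver ¬g))
    where
    to-big : ∀ y → T (heavy w y) → T (adj w y ∧ (3 ≤ᵇ d y))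
    to-big y h with size (d y)
    ... | is0 e = ⊥-elim (n≮0 (subst (0 <_) e (d-pos wy)))
      where wy = heavy⊑adj {w} {y} h
    ... | is1 e = ⊥-elim (leaf-light e (adj-flip (heavy⊑adj {w} {y} h)) ¬g (flip-T {h = heavy} heavy-sym h))
    ... | is2 e = ⊥-elim (path-light e (adj-flip (heavy⊑adj {w} {y} h)) ¬g (flip-T {h = heavy} heavy-sym h))
    ... | is3+ le = ∧⁺ (heavy⊑adj {w} {y} h) (≤⇒≤ᵇ le)

  kind-adj : ∀ {v y} → T (adj v y) → kind v y ≡ classify (d y) (g y)
  kind-adj {v} {y} vy with adj v y
  ... | true = refl

  kind-weak : ∀ {v y} → T (adj v y) → d y ≡ 2 → g y ≤ 1 → kind v y ≡ weak
  kind-weak {v} {y} vy e le = begin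
    kind v y                            ≡⟨ kind-adj vy ⟩
    classify (d y) (g y)                ≡⟨ cong (λ k → classify k (g y)) e ⟩
    (if g y ≤ᵇ 1 then weak else plain)  ≡⟨ cong (if_then weak else plain) (Equivalence.to T-≡ (≤⇒≤ᵇ le)) ⟩
    weak                                ∎
    where open ≡-Reasoning

  data KindView (v y : V) : Kind → Set where
    none  : ¬ T (adj v y) → KindView v y none
    leaf  : T (adj v y) → d y ≡ 1 → KindView v y leaf
    weak  : T (adj v y) → d y ≡ 2 → g y ≤ 1 → KindView v y weak
    plain : T (adj v y) → d y ≡ 2 → 2 ≤ g y → KindView v y plain
    big   : T (adj v y) → 3 ≤ d y → KindView v y big

  kindView : ∀ v y → KindView v y (kind v y)
  kindView v y with T? (adj v y)
  ... | no ¬vy = subst (KindView v y) (sym (kind-none (adj v y) ¬vy)) (none ¬vy)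
    where
    kind-none : ∀ t → ¬ T t → (if t then classify (d y) (g y) else none) ≡ none
    kind-none true  ¬t = ⊥-elim (¬t tt)
    kind-none false _  = refl
  ... | yes vy = subst (KindView v y) (sym (kind-adj vy)) (view (d y) refl)
    where
    view : ∀ k → d y ≡ k → KindView v y (classify k (g y))
    view 0 e = ⊥-elim (n≮0 (subst (0 <_) e (d-pos vy)))
    view 1 e = leaf vy e
    view 2 e with T? (g y ≤ᵇ 1)
    ... | yes le = subst (λ t → KindView v y (if t then weak else plain)) (sym (Equivalence.to T-≡ le))
                     (weak vy e (≤ᵇ⇒≤ _ _ le))
    ... | no ¬le = subst (λ t → KindView v y (if t then weak else plain)) (sym (≡false (g y ≤ᵇ 1) ¬le))
                     (plain vy e (≰⇒> (¬le ∘ ≤⇒≤ᵇ)))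
      where
      ≡false : ∀ t → ¬ T t → t ≡ false
      ≡false true  ¬t = ⊥-elim (¬t tt)
      ≡false false _  = refl
    view (suc (suc (suc k))) e = big vy (subst (3 ≤_) (sym e) (s≤s (s≤s (s≤s z≤n))))

  weigh≤total : ∀ {α β γ δ v f} →
    (∀ {y} → T (adj v y) → d y ≡ 1 → f y ≤ α) →
    (∀ {y} → T (adj v y) → d y ≡ 2 → g y ≤ 1 → f y ≤ β) →
    (∀ {y} → T (adj v y) → d y ≡ 2 → f y ≤ γ) →
    (∀ {y} → T (adj v y) → f y ≤ δ) →
    weigh (adj v) f ≤ total α β γ δ v
  weigh≤total {α} {β} {γ} {δ} {v} {f} l w q b = sum-mono λ y → pointwise y (kindView v y)
    where
    bound : ∀ {y k} → T (adj v y) → f y ≤ k → ⟦ adj v y ⟧ * f y ≤ k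
    bound {y} {k} vy le = subst (_≤ k) (sym (trans (cong (_* f y) (⟦⟧-true vy)) (*-identityˡ (f y)))) le

    pointwise : ∀ y {k} → KindView v y k → ⟦ adj v y ⟧ * f y ≤ value α β γ δ k
    pointwise y (none ¬vy)     = ≤-reflexive (cong (_* f y) (⟦⟧-false ¬vy))
    pointwise y (leaf vy e)    = bound vy (l vy e)
    pointwise y (weak vy e le) = bound vy (w vy e le)
    pointwise y (plain vy e _) = bound vy (q vy e)
    pointwise y (big vy _)     = bound vy (b vy)

  total-1 : ∀ v → total 1 1 1 1 v ≡ d v
  total-1 v = sum-cong-≗ λ y → pointwise y (kindView v y)
    where
    pointwise : ∀ y {k} → KindView v y k → value 1 1 1 1 k ≡ ⟦ adj v y ⟧
    pointwise y (none ¬vy)     = sym (⟦⟧-false ¬vy)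
    pointwise y (leaf vy _)    = sym (⟦⟧-true vy)
    pointwise y (weak vy _ _)  = sym (⟦⟧-true vy)
    pointwise y (plain vy _ _) = sym (⟦⟧-true vy)
    pointwise y (big vy _)     = sym (⟦⟧-true vy)

  p≡b : ∀ v → p v ≡ b v
  p≡b v = sum-cong-≗ λ y → pointwise y (kindView v y)
    where
    small : ∀ {y k} → d y ≡ k → k < 3 → ⟦ adj v y ∧ (3 ≤ᵇ d y) ⟧ ≡ 0
    small {y} e lt = ⟦⟧-false λ t →
      <⇒≱ lt (subst (3 ≤_) e (≤ᵇ⇒≤ 3 _ (proj₂ (∧⁻ {adj v y} t))))

    pointwise : ∀ y {k} → KindView v y k → ⟦ adj v y ∧ (3 ≤ᵇ d y) ⟧ ≡ value 0 0 0 1 k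
    pointwise y (none ¬vy)     = ⟦⟧-false (¬vy ∘ proj₁ ∘ ∧⁻ {adj v y})
    pointwise y (leaf _ e)     = small e (s≤s (s≤s z≤n))
    pointwise y (weak _ e _)   = small e ≤-refl
    pointwise y (plain _ e _)  = small e ≤-refl
    pointwise y (big vy le)    = ⟦⟧-true (∧⁺ vy (≤⇒≤ᵇ le))

  d-split : ∀ v → d v ≡ ℓ v + (a v + m v + b v)
  d-split v = trans (sym (total-1 v)) (trans (total-linear 1 1 1 1 v) (tidy (ℓ v) (a v) (m v) (b v)))
    where
    tidy : ∀ x y z w → (1 * x + 1 * y) + (1 * z + 1 * w) ≡ x + (y + z + w)
    tidy = solve-∀

  q : V → ℕ
  q v = a v + m v + b v

  -- The structure of irreducible graphs

  module _ (irreducible : Irreducible) where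

    -- The only edge at a leaf has to be the demanding one. There `Sh x` equals `hd v`, which
    -- cancels.
    leaf-demand : ∀ {x v} → d x ≡ 1 → T (adj x v) → 3 * D < Sh v
    leaf-demand {x} {v} e xv with irreducible x (subst (0 <_) (sym e) z<s)
    ... | y , xy , lt with single-unique {r = adj x} e xv xy
    ... | refl = +-cancelˡ-< (hd v) (3 * D) (Sh v) (begin-strict
      hd v + 3 * D             ≤⟨ +-monoˡ-≤ (3 * D) (m≤n+m (hd v) (hd x)) ⟩
      hd x + hd v + 3 * D      ≡⟨ +-comm (hd x + hd v) (3 * D) ⟩
      3 * D + (hd x + hd v)    <⟨ lt ⟩
      Sh x + Sh v              ≡⟨ cong (_+ Sh v) (weigh-single {r = adj x} e xv hd) ⟩
      hd v + Sh v              ∎)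
      where open ≤-Reasoning

    ℓ-some : ∀ {v} → 0 < ℓ v → ∃ λ x → T (adj x v) × d x ≡ 1
    ℓ-some {v} pos with sum-some {f = λ y → value 1 0 0 0 (kind v y)} pos
    ... | x , pos′ = x , extract (kindView v x) pos′
      where
      extract : ∀ {k} → KindView v x k → 0 < value 1 0 0 0 k → T (adj x v) × d x ≡ 1
      extract (leaf vx e) _ = adj-flip vx , e

    -- A leaf adds at most 1 to `Sh v` and any other neighbour at most `D`. With at most two
    -- non-leaves this gives `Sh v ≤ ℓ v + 2 * D ≤ 3 * D`, against `leaf-demand`. It is the reason
    -- why discarding leaves does not create new ones.
    many-nonleaves : ∀ {v} → 0 < ℓ v → 3 ≤ q v
    many-nonleaves {v} pos with 3 ≤? q v
    ... | yes le = le
    ... | no ¬le = ⊥-elim (<⇒≱ (leaf-demand (proj₂ (proj₂ (ℓ-some pos))) (proj₁ (proj₂ (ℓ-some pos)))) (begin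
      Sh v                  ≤⟨ weigh≤total {1} {D} {D} {D} {v} {hd}
                                 (λ {y} _ e → ≤-trans (hd≤d y) (≤-reflexive e))
                                 (λ {y} _ _ _ → hd≤D y) (λ {y} _ _ → hd≤D y) (λ {y} _ → hd≤D y) ⟩
      total 1 D D D v       ≡⟨ total-linear 1 D D D v ⟩
      (1 * ℓ v + D * a v) + (D * m v + D * b v)
                            ≡⟨ tidy D (ℓ v) (a v) (m v) (b v) ⟩
      ℓ v + q v * D         ≤⟨ +-mono-≤ ℓ≤D (*-monoˡ-≤ D (≤-pred (≰⇒> ¬le))) ⟩
      3 * D                 ∎))
      where
      open ≤-Reasoning
      hd≤D : ∀ y → hd y ≤ D
      hd≤D y = ≤-trans (hd≤d y) (deg≤D y)
      ℓ≤D : ℓ v ≤ D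
      ℓ≤D = ≤-trans (≤-trans (m≤m+n (ℓ v) (q v)) (≤-reflexive (sym (d-split v)))) (deg≤D v)
      tidy : ∀ D l a m b → (1 * l + D * a) + (D * m + D * b) ≡ l + (a + m + b) * D
      tidy = solve-∀

    nonleaf-q : ∀ v → 2 ≤ d v → 3 ≤ q v ⊎ q v ≡ d v
    nonleaf-q v _ with ℓ v in e | d-split v
    ... | zero  | eq = inj₂ (sym eq)
    ... | suc _ | _  = inj₁ (many-nonleaves (subst (0 <_) (sym e) z<s))

    -- The demanding edge at `u` is heavy, which `path-light` allows only towards a giver.
    giving-neighbour : ∀ {u} → d u ≡ 2 → ∃ λ v → T (adj u v) × T (giver v) × Demanding u v
    giving-neighbour {u} e with irreducible u (subst (0 <_) (sym e) z<s)
    ... | v , dem with T? (giver v)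
    ... | yes gv = v , proj₁ dem , gv , dem
    ... | no ¬gv = ⊥-elim (path-light e (proj₁ dem) ¬gv (demanding⇒heavy dem))

    weak-other : ∀ {v u} → T (giver v) → (uv : T (adj u v)) → (e : d u ≡ 2) → g u ≤ 1 →
                 ¬ T (giver (Pair.other (pair {r = adj u} e uv)))
    weak-other {v} {u} gv uv e le go = <⇒≱ (begin-strict
      1                             <⟨ ≤-refl ⟩
      1 + 1                         ≡⟨ cong₂ _+_ (⟦⟧-true gv) (⟦⟧-true go) ⟨
      ⟦ giver v ⟧ + ⟦ giver other ⟧   ≡⟨ weigh-pair (⟦_⟧ ∘ giver) ⟨
      g u                           ∎) le
      where
      open ≤-Reasoning
      open Pair (pair {r = adj u} e uv)

    hd-pair : ∀ {v u} → (uv : T (adj u v)) → (e : d u ≡ 2) →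
      hd u ≡ ⟦ heavy u v ⟧ + ⟦ heavy u (Pair.other (pair {r = adj u} e uv)) ⟧
    hd-pair {v} {u} uv e = trans (sum-cong-≗ absorb)
      (Pair.weigh-pair (pair {r = adj u} e uv) (λ y → ⟦ heavy u y ⟧))
      where
      absorb : ∀ y → ⟦ heavy u y ⟧ ≡ ⟦ adj u y ⟧ * ⟦ heavy u y ⟧
      absorb y with adj u y
      ... | true  = sym (+-identityʳ _)
      ... | false = refl

    hd-weak : ∀ {v u} → T (giver v) → T (adj v u) → d u ≡ 2 → g u ≤ 1 → hd u ≤ 1
    hd-weak {v} {u} gv vu e le = begin
      hd u                                   ≡⟨ hd-pair uv e ⟩
      ⟦ heavy u v ⟧ + ⟦ heavy u other ⟧        ≡⟨ cong (⟦ heavy u v ⟧ +_)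
                                                      (⟦⟧-false (path-light e other∈ (weak-other gv uv e le))) ⟩
      ⟦ heavy u v ⟧ + 0                       ≡⟨ +-identityʳ _ ⟩
      ⟦ heavy u v ⟧                           ≤⟨ ⟦⟧-mono {heavy u v} {true} _ ⟩
      1                                      ∎
      where
      open ≤-Reasoning
      uv = adj-flip vu
      open Pair (pair {r = adj u} e uv)

    -- The other neighbour of `u` is not a giver, so the demanding edge of `u` is `uv`. Apart from
    -- `hd v`, `Sh u` contains only the at most 2 heavy edges of that neighbour; one is offset by
    -- `1 ≤ hd u`, the other by the strictness of the demand.
    weak-demand : ∀ {v u} → T (giver v) → T (adj v u) → d u ≡ 2 → g u ≤ 1 → 3 * D ≤ Sh v
    weak-demand {v} {u} gv vu e le with giving-neighbour e
    ... | y , uy , gy , dem with Pair.exhaustive (pair {r = adj u} e (adj-flip vu)) uy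
    ... | inj₂ refl = ⊥-elim (weak-other gv (adj-flip vu) e le gy)
    ... | inj₁ refl = +-cancelˡ-≤ (hd v + 2) _ _ (begin
      hd v + 2 + 3 * D                ≡⟨ shuffle (hd v) (3 * D) ⟩
      suc (3 * D + (1 + hd v))        ≤⟨ s≤s (+-monoʳ-≤ (3 * D) (+-monoˡ-≤ (hd v) one≤)) ⟩
      suc (3 * D + (hd u + hd v))     ≤⟨ proj₂ dem ⟩
      Sh u + Sh v                     ≡⟨ cong (_+ Sh v) (weigh-pair hd) ⟩
      hd v + hd other + Sh v          ≤⟨ +-monoˡ-≤ (Sh v) (+-monoʳ-≤ (hd v)
                                           (hd-not-giver (weak-other gv (adj-flip vu) e le))) ⟩
      hd v + 2 + Sh v                 ∎)
      where
      open ≤-Reasoning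
      open Pair (pair {r = adj u} e (adj-flip vu))
      one≤ : 1 ≤ hd u
      one≤ = count-pos {r = heavy u} v (demanding⇒heavy dem)
      shuffle : ∀ h x → h + 2 + x ≡ suc (x + (1 + h))
      shuffle = solve-∀

    a-some : ∀ {v} → 0 < a v → ∃ λ u → T (adj v u) × d u ≡ 2 × g u ≤ 1
    a-some {v} pos with sum-some {f = λ y → value 0 1 0 0 (kind v y)} pos
    ... | u , pos′ = u , extract (kindView v u) pos′
      where
      extract : ∀ {k} → KindView v u k → 0 < value 0 1 0 0 k → T (adj v u) × d u ≡ 2 × g u ≤ 1
      extract (weak vu e le) _ = vu , e , le

    -- Leaves and weak neighbours impose the same lower bound, so `giver-balance` can treat them
    -- together, as `r`.
    busy : ∀ {v} → T (giver v) → 0 < ℓ v + a v → 3 * D ≤ Sh v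
    busy {v} gv pos with ℓ v in eℓ
    ... | suc _ = let _ , xv , e = ℓ-some (subst (0 <_) (sym eℓ) z<s) in <⇒≤ (leaf-demand e xv)
    ... | zero  = let _ , vu , e , le = a-some pos in weak-demand gv vu e le

    -- A plain neighbour counts 2 but a weak one only 1, since its edge to the neighbour that is not
    -- a giver is light.
    Sh-giver : ∀ {v} → T (giver v) → Sh v ≤ ℓ v + a v + 2 * m v + D * b v
    Sh-giver {v} gv = begin
      Sh v             ≤⟨ weigh≤total {1} {1} {2} {D} {v} {hd}
                            (λ {y} _ e → ≤-trans (hd≤d y) (≤-reflexive e))
                            (λ {y} vy e le → hd-weak gv vy e le)
                            (λ {y} _ e → ≤-trans (hd≤d y) (≤-reflexive e))
                            (λ {y} _ → ≤-trans (hd≤d y) (deg≤D y)) ⟩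
      total 1 1 2 D v  ≡⟨ total-linear 1 1 2 D v ⟩
      (1 * ℓ v + 1 * a v) + (2 * m v + D * b v) ≡⟨ tidy D (ℓ v) (a v) (m v) (b v) ⟩
      ℓ v + a v + 2 * m v + D * b v ∎
      where
      open ≤-Reasoning
      tidy : ∀ D l a m b → (1 * l + 1 * a) + (2 * m + D * b) ≡ l + a + 2 * m + D * b
      tidy = solve-∀

    S-bound : ∀ v → S v ≤ 2 * (ℓ v + a v) + 2 * m v + D * b v
    S-bound v = begin
      S v              ≤⟨ weigh≤total {2} {2} {2} {D} {v} {d}
                            (λ _ e → ≤-trans (≤-reflexive e) (n≤1+n 1))
                            (λ _ e _ → ≤-reflexive e) (λ _ e → ≤-reflexive e) (λ {y} _ → deg≤D y) ⟩
      total 2 2 2 D v  ≡⟨ total-linear 2 2 2 D v ⟩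
      (2 * ℓ v + 2 * a v) + (2 * m v + D * b v) ≡⟨ tidy D (ℓ v) (a v) (m v) (b v) ⟩
      2 * (ℓ v + a v) + 2 * m v + D * b v ∎
      where
      open ≤-Reasoning
      tidy : ∀ D l a m b → (2 * l + 2 * a) + (2 * m + D * b) ≡ 2 * (l + a) + 2 * m + D * b
      tidy = solve-∀

    S≤dD : ∀ v → S v ≤ d v * D
    S≤dD v = ≤-trans (weigh-mono {r = adj v} {g = const D} id deg≤D) (≤-reflexive (weigh-const {r = adj v} D))

    S-giver : ∀ {v} → T (giver v) → b v ≤ 2 → 2 * D + 3 ≤ S v
    S-giver {v} gv b≤2 with Equivalence.to (T-∨ {3 ≤ᵇ p v}) gv
    ... | inj₂ t = ≤ᵇ⇒≤ _ _ t
    ... | inj₁ t = ⊥-elim (<⇒≱ (subst (3 ≤_) (p≡b v) (≤ᵇ⇒≤ _ _ t)) b≤2)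

    giver-3 : ∀ {v} → T (giver v) → 3 ≤ d v
    giver-3 {v} gv with 3 ≤? d v
    ... | yes le = le
    ... | no ¬le = ⊥-elim (<⇒≱ (begin-strict
      S v          ≤⟨ S≤dD v ⟩
      d v * D      ≤⟨ *-monoˡ-≤ D (≤-pred (≰⇒> ¬le)) ⟩
      2 * D        <⟨ m<m+n (2 * D) z<s ⟩
      2 * D + 3    ∎) (S-giver gv (≤-trans b≤d (≤-pred (≰⇒> ¬le)))))
      where
      open ≤-Reasoning
      b≤d : b v ≤ d v
      b≤d = ≤-trans (≤-trans (m≤n+m (b v) (a v + m v)) (m≤n+m (q v) (ℓ v))) (≤-reflexive (sym (d-split v)))

    -- A weak neighbour brings in the 2 that it is paid, a plain one keeps 1 of its 2, and a big one
    -- keeps 2; what has to be shown is `6 ≤ 2 * b v + m v`. Otherwise `b v ≤ 2`, and the degrees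
    -- around `v` are too small: for `S-giver` if `v` has neither leaves nor weak neighbours, and
    -- for `busy` if it has some.
    giver-balance : ∀ {v} → T (giver v) → 6 + (2 * a v + m v) ≤ 2 * q v
    giver-balance {v} gv with 6 ≤? 2 * b v + m v
    ... | yes le = begin
      6 + (2 * a v + m v)                    ≤⟨ +-monoˡ-≤ (2 * a v + m v) le ⟩
      2 * b v + m v + (2 * a v + m v)        ≡⟨ tidy (a v) (m v) (b v) ⟩
      2 * q v                                ∎
      where
      open ≤-Reasoning
      tidy : ∀ a m b → 2 * b + m + (2 * a + m) ≡ 2 * (a + m + b)
      tidy = solve-∀
    ... | no ¬le = ⊥-elim (impossible (b v) (ℓ v + a v) (m v) (≤-pred (≰⇒> ¬le)) within
                     (S-giver gv) (S-bound v) (λ pos → ≤-trans (busy gv pos) (Sh-giver gv)))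
      where
      within : ℓ v + a v + m v + b v ≤ D
      within = ≤-trans (≤-reflexive (trans (tidy (ℓ v) (a v) (m v) (b v)) (sym (d-split v)))) (deg≤D v)
        where
        tidy : ∀ l a m b → l + a + m + b ≡ l + (a + m + b)
        tidy = solve-∀

      3≤D : 3 ≤ D
      3≤D = ≤-trans (giver-3 gv) (deg≤D v)

      -- Each case adds up its hypotheses to `x ≤ y`, and the ring solver then shows that `x`
      -- exceeds `y` by `suc k`.
      contra : ∀ {x y z} k → x ≤ y → z + suc k ≡ x → z ≡ y → ⊥
      contra {z = z} k le ex refl = m+1+n≰m z (subst (_≤ z) (sym ex) le)

      impossible : ∀ b r m → 2 * b + m ≤ 5 → r + m + b ≤ D → (b ≤ 2 → 2 * D + 3 ≤ S v) →
        S v ≤ 2 * r + 2 * m + D * b → (0 < r → 3 * D ≤ r + 2 * m + D * b) → ⊥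
      impossible (suc (suc (suc b))) r m few _ _ _ _ =
        contra (2 * b + m) few (shape b m) refl
        where
        shape : ∀ b m → 5 + suc (2 * b + m) ≡ 2 * (3 + b) + m
        shape = solve-∀
      impossible 0 zero m few cap low high _ =
        contra 2 (+-mono-≤ (≤-trans (low z≤n) high) (*-monoʳ-≤ 2 cap)) (lhs D m) (rhs D m)
        where
        lhs : ∀ D m → 2 * D + 2 * m + 3 ≡ (2 * D + 3) + 2 * (m + 0)
        lhs = solve-∀
        rhs : ∀ D m → 2 * D + 2 * m ≡ (0 + 2 * m + D * 0) + 2 * D
        rhs = solve-∀
      impossible 1 zero m few cap low high _ =
        contra 0 (+-mono-≤ (+-mono-≤ (≤-trans (low (s≤s z≤n)) high) cap) few) (lhs D m) (rhs D m)
        where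
        lhs : ∀ D m → 2 * D + 2 * m + 5 + 1 ≡ (2 * D + 3) + (m + 1) + (2 + m)
        lhs = solve-∀
        rhs : ∀ D m → 2 * D + 2 * m + 5 ≡ (0 + 2 * m + D * 1) + D + 5
        rhs = solve-∀
      impossible 2 zero m few cap low high _ =
        contra 0 (+-mono-≤ (≤-trans (low ≤-refl) high) (*-monoʳ-≤ 2 few)) (lhs D m) (rhs D m)
        where
        lhs : ∀ D m → 2 * m + D * 2 + 10 + 1 ≡ (2 * D + 3) + 2 * (4 + m)
        lhs = solve-∀
        rhs : ∀ D m → 2 * m + D * 2 + 10 ≡ (0 + 2 * m + D * 2) + 2 * 5
        rhs = solve-∀
      impossible 0 r@(suc _) m few cap _ _ demand =
        contra 0 (+-mono-≤ (+-mono-≤ (demand z<s) cap) (+-mono-≤ few (*-monoʳ-≤ 2 3≤D))) (lhs D m r) (rhs D m r)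
        where
        lhs : ∀ D m r → r + 2 * m + 3 * D + 5 + 1 ≡ (3 * D + (r + m + 0)) + (m + 2 * 3)
        lhs = solve-∀
        rhs : ∀ D m r → r + 2 * m + 3 * D + 5 ≡ ((r + 2 * m + D * 0) + D) + (5 + 2 * D)
        rhs = solve-∀
      impossible 1 r@(suc _) m few cap _ _ demand =
        contra 0 (+-mono-≤ (+-mono-≤ (demand z<s) cap) (+-mono-≤ few 3≤D)) (lhs D m r) (rhs D m r)
        where
        lhs : ∀ D m r → r + 2 * m + 3 * D + 5 + 1 ≡ (3 * D + (r + m + 1)) + ((2 + m) + 3)
        lhs = solve-∀
        rhs : ∀ D m r → r + 2 * m + 3 * D + 5 ≡ ((r + 2 * m + D * 1) + D) + (5 + D)
        rhs = solve-∀
      impossible 2 r@(suc _) m few cap _ _ demand =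
        contra 0 (+-mono-≤ (+-mono-≤ (demand z<s) cap) few) (lhs D m r) (rhs D m r)
        where
        lhs : ∀ D m r → r + 2 * m + 3 * D + 5 + 1 ≡ (3 * D + (r + m + 2)) + (4 + m)
        lhs = solve-∀
        rhs : ∀ D m r → r + 2 * m + 3 * D + 5 ≡ ((r + 2 * m + D * 2) + D) + 5
        rhs = solve-∀

    -- The core and its final charge

    nonleaf : V → Bool
    nonleaf v = 2 ≤ᵇ d v

    core : Mask n
    core u v = adj u v ∧ (nonleaf u ∧ nonleaf v)

    core-sym : Symmetric core
    core-sym u v = cong₂ _∧_ (adj-sym u v) (∧-comm (nonleaf u) (nonleaf v))

    core⊑adj : core ⊑ adj
    core⊑adj {u} {v} t = proj₁ (∧⁻ {adj u v} t)

    flow : V → V → ℕ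
    flow v u = ⟦ giver v ⟧ * value 0 2 1 0 (kind v u)

    out inn : V → ℕ
    out v = ∑[ u < n ] flow v u
    inn u = ∑[ v < n ] flow v u

    deg-core : ∀ {v} → 2 ≤ d v → deg core v ≡ q v
    deg-core {v} nl = trans (sum-cong-≗ λ y → pointwise y (kindView v y))
      (trans (total-linear 0 1 1 1 v) (tidy (ℓ v) (a v) (m v) (b v)))
      where
      tidy : ∀ l a m b → (0 * l + 1 * a) + (1 * m + 1 * b) ≡ a + m + b
      tidy = solve-∀

      inside : ∀ {y} → T (adj v y) → 2 ≤ d y → 1 ≡ ⟦ core v y ⟧
      inside {y} vy le = sym (⟦⟧-true (∧⁺ vy (∧⁺ (≤⇒≤ᵇ nl) (≤⇒≤ᵇ le))))

      pointwise : ∀ y {k} → KindView v y k → ⟦ core v y ⟧ ≡ value 0 1 1 1 k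
      pointwise y (none ¬vy)     = ⟦⟧-false λ t → ¬vy (core⊑adj {v} {y} t)
      pointwise y (leaf vy e)    = ⟦⟧-false λ t → <⇒≱ ≤-refl (subst (2 ≤_) e
        (≤ᵇ⇒≤ 2 (d y) (proj₂ (∧⁻ {nonleaf v} (proj₂ (∧⁻ {adj v y} t))))))
      pointwise y (weak vy e _)  = sym (inside vy (≤-reflexive (sym e)))
      pointwise y (plain vy e _) = sym (inside vy (≤-reflexive (sym e)))
      pointwise y (big vy le)    = sym (inside vy (≤-trans (n≤1+n 2) le))

    -- Whether `u` is weak or plain depends on `u` alone. So it gets 2 from one giver, or 1 from
    -- each of at least two, which covers its initial charge of -2 when neither neighbour is a leaf.
    inn-2 : ∀ {u} → d u ≡ 2 → 2 ≤ inn u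
    inn-2 {u} e with g u ≤? 1
    ... | yes le =
      let v , uv , gv , _ = giving-neighbour e
      in ≤-trans (≤-reflexive (sym (cong₂ (λ x k → x * value 0 2 1 0 k)
                                           (⟦⟧-true gv) (kind-weak (adj-flip uv) e le))))
                 (term≤sum (λ v → flow v u) v)
    ... | no ¬le = ≤-trans (≰⇒> ¬le) (sum-mono λ v → pointwise v (kindView v u))
      where
      pointwise : ∀ v {k} → KindView v u k → ⟦ adj u v ⟧ * ⟦ giver v ⟧ ≤ ⟦ giver v ⟧ * value 0 2 1 0 k
      pointwise v (none ¬vu)     = ≤-trans (≤-reflexive (cong (_* ⟦ giver v ⟧) (⟦⟧-false (¬vu ∘ adj-flip)))) z≤n
      pointwise v (leaf _ e′)    with () ← trans (sym e) e′
      pointwise v (weak _ _ le)  = ⊥-elim (¬le le)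
      pointwise v (plain vu _ _) = ≤-reflexive (trans (cong (_* ⟦ giver v ⟧) (⟦⟧-true (adj-flip vu)))
                                                      (*-comm 1 ⟦ giver v ⟧))
      pointwise v (big _ le)     = ⊥-elim (<⇒≱ ≤-refl (subst (3 ≤_) e le))

    out-giver : ∀ {v} → T (giver v) → out v ≡ 2 * a v + m v
    out-giver {v} gv = begin
      out v                          ≡⟨ *-distribˡ-sum ⟦ giver v ⟧ (λ u → value 0 2 1 0 (kind v u)) ⟨
      ⟦ giver v ⟧ * total 0 2 1 0 v   ≡⟨ cong₂ _*_ (⟦⟧-true gv) (total-linear 0 2 1 0 v) ⟩
      1 * ((0 * ℓ v + 2 * a v) + (1 * m v + 0 * b v)) ≡⟨ tidy (ℓ v) (a v) (m v) (b v) ⟩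
      2 * a v + m v                  ∎
      where
      open ≡-Reasoning
      tidy : ∀ l a m b → 1 * ((0 * l + 2 * a) + (1 * m + 0 * b)) ≡ 2 * a + m
      tidy = solve-∀

    out-not-giver : ∀ {v} → ¬ T (giver v) → out v ≡ 0
    out-not-giver {v} ¬gv = sum-zero λ u → cong (_* value 0 2 1 0 (kind v u)) (⟦⟧-false ¬gv)

    -- The final charge is nonnegative, written without subtraction. Outside the core the left side
    -- is 0, because a giver has degree at least 3.
    balance : ∀ v → 6 * ⟦ nonleaf v ⟧ + out v ≤ 2 * deg core v + inn v
    balance v with T? (giver v)
    ... | yes gv = begin
      6 * ⟦ nonleaf v ⟧ + out v     ≡⟨ cong₂ (λ x y → 6 * x + y) (⟦⟧-true (≤⇒≤ᵇ 2≤d)) (out-giver gv) ⟩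
      6 + (2 * a v + m v)          ≤⟨ giver-balance gv ⟩
      2 * q v                      ≡⟨ cong (2 *_) (deg-core 2≤d) ⟨
      2 * deg core v               ≤⟨ m≤m+n _ _ ⟩
      2 * deg core v + inn v       ∎
      where
      open ≤-Reasoning
      2≤d : 2 ≤ d v
      2≤d = ≤-trans (n≤1+n 2) (giver-3 gv)
    ... | no ¬gv with 2 ≤? d v
    ... | no ¬2≤d = ≤-trans (≤-reflexive (cong₂ (λ x y → 6 * x + y)
                      (⟦⟧-false (¬2≤d ∘ ≤ᵇ⇒≤ 2 (d v))) (out-not-giver ¬gv))) z≤n
    ... | yes 2≤d = begin
      6 * ⟦ nonleaf v ⟧ + out v     ≡⟨ cong₂ (λ x y → 6 * x + y) (⟦⟧-true (≤⇒≤ᵇ 2≤d)) (out-not-giver ¬gv) ⟩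
      6                            ≤⟨ supply ⟩
      2 * q v + inn v              ≡⟨ cong (λ x → 2 * x + inn v) (deg-core 2≤d) ⟨
      2 * deg core v + inn v       ∎
      where
      open ≤-Reasoning
      plenty : 3 ≤ q v → 6 ≤ 2 * q v + inn v
      plenty le = ≤-trans (*-monoʳ-≤ 2 le) (m≤m+n _ _)
      supply : 6 ≤ 2 * q v + inn v
      supply with nonleaf-q v 2≤d | d v ≟ℕ 2
      ... | inj₁ le | _ = plenty le
      ... | inj₂ e  | no d≢2 = plenty (subst (3 ≤_) (sym e) (≤∧≢⇒< 2≤d (d≢2 ∘ sym)))
      ... | inj₂ e  | yes d≡2 = 
        +-mono-≤ {4} {2 * q v} {2} (*-monoʳ-≤ 2 (≤-reflexive (sym (trans e d≡2)))) (inn-2 d≡2)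

    -- In the sum of `balance` over all vertices the payments cancel: `∑-comm` identifies what is
    -- sent with what is received.
    dense : 3 * ∑[ v < n ] ⟦ nonleaf v ⟧ ≤ ∑[ v < n ] deg core v
    dense = *-cancelˡ-≤ 2 (+-cancelʳ-≤ flowing _ _ (begin
      2 * (3 * N) + flowing
        ≡⟨ cong (_+ flowing) (*-assoc 2 3 N) ⟨
      6 * N + flowing
        ≡⟨ cong (_+ flowing) (*-distribˡ-sum 6 (⟦_⟧ ∘ nonleaf)) ⟩
      ∑[ v < n ] (6 * ⟦ nonleaf v ⟧) + flowing
        ≡⟨ ∑-distrib-+ (λ v → 6 * ⟦ nonleaf v ⟧) out ⟨
      ∑[ v < n ] (6 * ⟦ nonleaf v ⟧ + out v)
        ≤⟨ sum-mono balance ⟩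
      ∑[ v < n ] (2 * deg core v + inn v)
        ≡⟨ ∑-distrib-+ (λ v → 2 * deg core v) inn ⟩
      ∑[ v < n ] (2 * deg core v) + ∑[ v < n ] inn v
        ≡⟨ cong₂ _+_ (*-distribˡ-sum 2 (deg core)) (∑-comm flow) ⟨
      2 * ∑[ v < n ] deg core v + flowing ∎))
      where
      open ≤-Reasoning
      N = ∑[ v < n ] ⟦ nonleaf v ⟧
      flowing = ∑[ v < n ] out v

    core-nonleaf : ∀ {u v} → T (core u v) → 2 ≤ d u
    core-nonleaf {u} {v} t = ≤ᵇ⇒≤ 2 (d u) (proj₁ (∧⁻ {nonleaf u} (proj₂ (∧⁻ {adj u v} t))))

    core-deg : ∀ {u} → 2 ≤ d u → 2 ≤ deg core u
    core-deg {u} nl with nonleaf-q u nl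
    ... | inj₁ le = subst (2 ≤_) (sym (deg-core nl)) (≤-trans (n≤1+n 2) le)
    ... | inj₂ e  = subst (2 ≤_) (sym (trans (deg-core nl) e)) nl

    -- If `x` is a leaf, `many-nonleaves` puts `y` into the core, and a core vertex has core edges.
    core-edge : ∀ {x y} → T (adj x y) → ∃₂ λ u v → T (core u v)
    core-edge {x} {y} xy =
      let u , nl = inhabited in u , count-some {r = core u} (≤-trans (s≤s z≤n) (core-deg nl))
      where
      inhabited : ∃ λ u → 2 ≤ d u
      inhabited with 2 ≤? d x
      ... | yes le = x , le
      ... | no ¬le = y , ≤-trans (≤-trans (n≤1+n 2) (many-nonleaves leafy))
                                 (≤-trans (m≤n+m (q y) (ℓ y)) (≤-reflexive (sym (d-split y))))
        where
        one-x : d x ≡ 1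
        one-x = ≤-antisym (≤-pred (≰⇒> ¬le)) (d-pos (adj-flip xy))
        leafy : 0 < ℓ y
        leafy = ≤-trans (≤-reflexive (sym (cong (value 1 0 0 0)
                  (trans (kind-adj (adj-flip xy)) (cong (λ k → classify k (g x)) one-x)))))
                  (term≤sum (λ z → value 1 0 0 0 (kind y z)) x)

-- Sparse graphs: reduction and induction

-- Nonempty subgraphs of minimum degree at least 2, with isolated vertices ignored, have average
-- degree below 3. Quantifying over all subgraphs makes the property hereditary, so the induction
-- need not carry an embedding along.
Sparse : ∀ {n} → Mask n → Set
Sparse {n} adj = ∀ h → Symmetric h → h ⊑ adj → (∀ {u v} → T (h u v) → 2 ≤ deg h u) →
  ∀ {u v} → T (h u v) → sum (deg h) < 3 * ∑[ v < n ] ⟦ 0 <ᵇ deg h v ⟧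

module _ {n : ℕ} where

  isolate : Mask n → Fin n → Mask n
  isolate adj x u v = without (adj u) x v ∧ not (does (u ≟ x))

  isolate⁻ : ∀ {adj x u v} → T (isolate adj x u v) → T (adj u v) × u ≢ x × v ≢ x
  isolate⁻ {adj} {x} {u} {v} t
    with without⁻ {r = adj u} (proj₁ (∧⁻ {without (adj u) x v} t)) | u ≟ x | proj₂ (∧⁻ {without (adj u) x v} t)
  ... | uv , v≢x | no u≢x | _ = uv , u≢x , v≢x

  isolate⁺ : ∀ {adj x u v} → T (adj u v) → u ≢ x → v ≢ x → T (isolate adj x u v)
  isolate⁺ {adj} {x} {u} {v} uv u≢x v≢x = ∧⁺ (without⁺ {r = adj u} uv v≢x) different
    where
    different : T (not (does (u ≟ x)))
    different with u ≟ x
    ... | yes e = u≢x e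
    ... | no _  = tt

  T-ext : ∀ {b c} → (T b → T c) → (T c → T b) → b ≡ c
  T-ext {true}  {true}  _ _ = refl
  T-ext {true}  {false} f _ = ⊥-elim (f tt)
  T-ext {false} {true}  _ g = ⊥-elim (g tt)
  T-ext {false} {false} _ _ = refl

  isolate-sym : ∀ {adj} → Symmetric adj → ∀ {x} → Symmetric (isolate adj x)
  isolate-sym {adj} adj-sym {x} u v = T-ext (turn {u} {v}) (turn {v} {u})
    where
    turn : ∀ {u v} → T (isolate adj x u v) → T (isolate adj x v u)
    turn t = let uv , u≢x , v≢x = isolate⁻ {adj} t in isolate⁺ {adj} (flip-T {h = adj} adj-sym uv) v≢x u≢x

module _ {n : ℕ} (D : ℕ) {adj : Mask n} (adj-sym : Symmetric adj) (deg≤D : ∀ v → deg adj v ≤ D) where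

  open Discharging adj adj-sym D deg≤D
  open Greedy {k = suc (3 * D)} adj adj-sym

  weigh-both : ∀ {u v} → T (adj u v) → ∀ f →
    weigh (without (adj u) v) f + weigh (without (adj v) u) f + (f u + f v) ≡ weigh (adj u) f + weigh (adj v) f
  weigh-both {u} {v} uv f = sym (trans
    (cong₂ _+_ (weigh-without {r = adj u} v f uv) (weigh-without {r = adj v} u f (adj-flip uv)))
    (shuffle (f u) (f v) (weigh (without (adj u) v) f) (weigh (without (adj v) u) f)))
    where
    shuffle : ∀ a b x y → b + x + (a + y) ≡ x + y + (a + b)
    shuffle = solve-∀

  few : ∀ {u v} → T (adj u v) → ∀ f → weigh (adj u) f + weigh (adj v) f ≤ 3 * D + (f u + f v) →
    weigh (without (adj u) v) f + weigh (without (adj v) u) f < suc (3 * D)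
  few {u} {v} uv f le = s≤s (+-cancelʳ-≤ (f u + f v) _ _ (≤-trans (≤-reflexive (weigh-both uv f)) le))

  demanding? : ∀ u v → Dec (Demanding u v)
  demanding? u v = T? (adj u v) ×-dec (_ <? _)

  demanding-sym : ∀ {u v} → Demanding u v → Demanding v u
  demanding-sym {u} {v} (uv , lt) = adj-flip uv ,
    subst₂ (λ s t → 3 * D + s < t) (+-comm (hd u) (hd v)) (+-comm (Sh u) (Sh v)) lt

  recolour : ∀ {x} → (∀ y → ¬ Demanding x y) →
    ∃ (Greedy.Proper {k = suc (3 * D)} (isolate adj x) (isolate-sym adj-sym) (isolate adj x)) →
    ∃ (Proper adj)
  recolour {x} calm (c , proper) = proj₁ last , proj₂ last
    where
    -- `heavy` refers to the whole graph, with `x`. Light edges forget the colours they had, as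
    -- `last` colours them anew.
    kept : Mask n
    kept u v = heavy u v ∧ isolate adj x u v

    kept-proper : Proper kept c
    kept-proper = record
      { symmetric = Greedy.Proper.symmetric proper
      ; strong    = λ u v y z uv yz ¬same close →
          let uv′ = proj₂ (∧⁻ {heavy u v} uv)
              yz′ = proj₂ (∧⁻ {heavy y z} yz)
          in Greedy.Proper.strong proper u v y z uv′ yz′ ¬same
               (restrict (isolate⁻ {adj = adj} uv′) (isolate⁻ {adj = adj} yz′) close)
      }
      where
      off : ∀ {a u v} → a ≡ u ⊎ a ≡ v → u ≢ x → v ≢ x → a ≢ x
      off (inj₁ refl) u≢x _ = u≢x
      off (inj₂ refl) _ v≢x = v≢x

      -- An edge joining two edges that avoid `x` avoids `x` as well. So deleting a vertex, unlike
      -- deleting a single edge, loses no conflict between the remaining edges.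
      restrict : ∀ {u v y z} → T (adj u v) × u ≢ x × v ≢ x → T (adj y z) × y ≢ x × z ≢ x →
        Close u v y z → Greedy.Close {k = suc (3 * D)} (isolate adj x) (isolate-sym adj-sym) u v y z
      restrict (_ , u≢x , v≢x) (_ , y≢x , z≢x) (a , b , a∈ , b∈ , inj₁ e) = a , b , a∈ , b∈ , inj₁ e
      restrict (_ , u≢x , v≢x) (_ , y≢x , z≢x) (a , b , a∈ , b∈ , inj₂ ab) = a , b , a∈ , b∈ ,
        inj₂ (isolate⁺ {adj = adj} ab (off a∈ u≢x v≢x) (off b∈ y≢x z≢x))

    calm-edge : ∀ {u v} → T (adj u v) → ¬ Demanding u v → load heavy u v < suc (3 * D)
    calm-edge uv ¬dem = few uv hd (≮⇒≥ λ lt → ¬dem (uv , lt))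

    first : ∃ (Proper heavy)
    first = extendTo {F₀ = kept} {heavy} (λ {u} {v} t → proj₁ (∧⁻ {heavy u v} t))
      (λ {u} {v} → heavy⊑adj {u} {v})
      (λ u v → cong₂ _∧_ (heavy-sym u v) (isolate-sym adj-sym u v)) heavy-sym kept-proper at-x
      where
      at-x : ∀ {u v} → T (heavy u v) → ¬ T (kept u v) → load heavy u v < suc (3 * D)
      at-x {u} {v} h ¬kept = cases (u ≟ x) (v ≟ x)
        where
        uv = heavy⊑adj {u} {v} h
        cases : Dec (u ≡ x) → Dec (v ≡ x) → load heavy u v < suc (3 * D)
        cases (yes refl) _          = calm-edge uv (calm v)
        cases (no _)     (yes refl) = calm-edge uv (calm u ∘ demanding-sym)
        cases (no u≢x)   (no v≢x)   = ⊥-elim (¬kept (∧⁺ h (isolate⁺ {adj = adj} uv u≢x v≢x)))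

    last : ∃ (Proper adj)
    last = extendTo {F₀ = heavy} {adj} (λ {u} {v} → heavy⊑adj {u} {v}) id heavy-sym adj-sym (proj₂ first)
      λ {u} {v} uv ¬h → few uv d (light-bound uv ¬h)

  sparse-reducible : Sparse adj → ∀ {x y} → T (adj x y) → ∃ λ x → 0 < d x × (∀ y → ¬ Demanding x y)
  sparse-reducible sparse {x} {y} xy
    with any? (λ x → (0 <? d x) ×-dec all? (λ y → ¬? (demanding? x y)))
  ... | yes found = found
  ... | no ¬found = ⊥-elim (<⇒≱ (sparse (core irreducible) (core-sym irreducible)
            (λ {u} {v} → core⊑adj irreducible {u} {v})
            (λ {u} {v} t → core-deg irreducible (core-nonleaf irreducible {u} {v} t))
            (proj₂ (proj₂ (core-edge irreducible xy))))
          (≤-trans (*-monoʳ-≤ 3 (sum-mono fewer)) (dense irreducible)))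
    where
    irreducible : Irreducible
    irreducible x pos with any? (demanding? x)
    ... | yes found = found
    ... | no ¬dem = ⊥-elim (¬found (x , pos , λ y dem → ¬dem (y , dem)))

    fewer : ∀ v → ⟦ 0 <ᵇ deg (core irreducible) v ⟧ ≤ ⟦ nonleaf irreducible v ⟧
    fewer v = ⟦⟧-mono λ t → let _ , e = count-some {r = core irreducible v} (<ᵇ⇒< 0 _ t)
                            in ≤⇒≤ᵇ (core-nonleaf irreducible {v} e)

sparse-⊑ : ∀ {n} {adj adj′ : Mask n} → adj′ ⊑ adj → Sparse adj → Sparse adj′
sparse-⊑ le sparse h h-sym h⊑ = sparse h h-sym (λ {u} {v} t → le {u} {v} (h⊑ {u} {v} t))

module _ {n : ℕ} (D : ℕ) where

  open Greedy using (Proper)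

  -- `D` stays fixed while the degrees shrink, so the palette is the same at every stage. The
  -- recursion is on a bound for the number of darts, which drops because `x` has an edge.
  sparse-colouring : (adj : Mask n) (adj-sym : Symmetric adj) → (∀ v → deg adj v ≤ D) → Sparse adj →
    ∃ (Proper {k = suc (3 * D)} adj adj-sym adj)
  sparse-colouring adj adj-sym deg≤D sparse =
    go (sum (deg adj)) adj adj-sym deg≤D (sparse-⊑ {adj = adj} id sparse) ≤-refl
    where
    go : ∀ size (adj : Mask n) (adj-sym : Symmetric adj) →
         (∀ v → deg adj v ≤ D) → Sparse adj → sum (deg adj) ≤ size →
         ∃ (Proper {k = suc (3 * D)} adj adj-sym adj)
    go size adj adj-sym deg≤D sparse bound with any? (λ x → any? (λ y → T? (adj x y)))
    go size adj adj-sym deg≤D sparse bound | no ¬found = (λ _ _ → zero) , record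
      { symmetric = λ _ _ → refl
      ; strong    = λ u v _ _ uv → ⊥-elim (¬found (u , v , uv))
      }
    go size adj adj-sym deg≤D sparse bound | yes (_ , _ , xy)
      with sparse-reducible D adj-sym deg≤D sparse xy
    go zero adj _ _ _ bound | yes _ | x , pos , _ =
      ⊥-elim (n≮0 (≤-trans pos (≤-trans (term≤sum (deg adj) x) bound)))
    go (suc size) adj adj-sym deg≤D sparse bound | yes _ | x , pos , calm =
      recolour D adj-sym deg≤D calm
        (go size (isolate adj x) (isolate-sym adj-sym) (λ v → ≤-trans (smaller v) (deg≤D v))
            (sparse-⊑ {adj = adj} (λ {u} {v} → inside {u} {v}) sparse)
            (≤-pred (≤-trans (sum-mono-< smaller x (subst (_< deg adj x) (sym isolated) pos)) bound)))
      where
      inside : isolate adj x ⊑ adj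
      inside t = proj₁ (isolate⁻ {adj = adj} t)
      smaller : ∀ v → deg (isolate adj x) v ≤ deg adj v
      smaller = deg-mono {h = isolate adj x} {adj} (λ {u} {v} → inside {u} {v})
      isolated : deg (isolate adj x) x ≡ 0
      isolated = sum-zero λ y → ⟦⟧-false λ t → proj₁ (proj₂ (isolate⁻ {adj = adj} {x} {x} {y} t)) refl

-- Orbits and transpositions

lookup-injective : ∀ {A : Set} {xs : List A} → Unique xs → Injective _≡_ _≡_ (lookup xs)
lookup-injective (_ ∷ _)  {zero}  {zero}  _ = refl
lookup-injective (x∉ ∷ _) {zero}  {suc j} e = ⊥-elim (All.lookup x∉ (∈-lookup j) e)
lookup-injective (x∉ ∷ _) {suc i} {zero}  e = ⊥-elim (All.lookup x∉ (∈-lookup i) (sym e))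
lookup-injective (_ ∷ u)  {suc i} {suc j} e = cong suc (lookup-injective u e)

module _ {k : ℕ} {i j : Fin (suc k)} (i≢j : i ≢ j) where

  -- The quotient map that identifies `j` with `i`.
  collapse : Fin (suc k) → Fin k
  collapse z with j Fin.≟ z
  ... | yes _  = punchOut (i≢j ∘ sym)
  ... | no j≢z = punchOut j≢z

  collapse-joins : collapse i ≡ collapse j
  collapse-joins with j Fin.≟ i | j Fin.≟ j
  ... | yes e | _     = ⊥-elim (i≢j (sym e))
  ... | no _  | yes _ = punchOut-cong j refl
  ... | no _  | no ¬e = ⊥-elim (¬e refl)

  collapse-only : ∀ {z w} → collapse z ≡ collapse w → z ≡ w ⊎ (z ≡ i × w ≡ j) ⊎ (z ≡ j × w ≡ i)
  collapse-only {z} {w} e with j Fin.≟ z | j Fin.≟ w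
  ... | yes p | yes q = inj₁ (trans (sym p) q)
  ... | yes p | no q  = inj₂ (inj₂ (sym p , sym (punchOut-injective (i≢j ∘ sym) q e)))
  ... | no p  | yes q = inj₂ (inj₁ (punchOut-injective p (i≢j ∘ sym) e , sym q))
  ... | no p  | no q  = inj₁ (punchOut-injective p q e)

  collapse-punchIn : ∀ t → collapse (punchIn j t) ≡ t
  collapse-punchIn t with j Fin.≟ punchIn j t
  ... | yes e = ⊥-elim (punchInᵢ≢i j t (sym e))
  ... | no _  = trans (punchOut-cong j refl) (punchOut-punchIn j)

module _ {A : Set} where

  classes-resp : ∀ {R S : Rel A 0ℓ} {k} → (∀ x y → R x y → S x y) → (∀ x y → S x y → R x y) →
                 R HasClasses k → S HasClasses k
  classes-resp RS SR (class , eq , surj) =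
    class , (λ x y → mk⇔ (to (eq x y) ∘ SR x y) (RS x y ∘ from (eq x y))) , surj

  representative : ∀ {R : Rel A 0ℓ} {k} ((class , _) : R HasClasses k) → ∀ i → ∃ λ a → class a ≡ i
  representative (_ , _ , surj) i = proj₁ (surj i) , proj₂ (surj i) refl

  coarser⇒fewer : ∀ {R S : Rel A 0ℓ} {k l} → (∀ x y → S x y → R x y) →
                  R HasClasses k → S HasClasses l → k ≤ l
  coarser⇒fewer SR cR@(classR , eqR , _) (classS , eqS , _) =
    injective⇒≤ {f = λ i → classS (proj₁ (representative cR i))} λ {i} {j} e →
      trans (sym (proj₂ (representative cR i)))
        (trans (to (eqR _ _) (SR _ _ (from (eqS _ _) e))) (proj₂ (representative cR j)))

  classes-unique : ∀ {R : Rel A 0ℓ} {k l} → R HasClasses k → R HasClasses l → k ≡ l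
  classes-unique c c′ = ≤-antisym (coarser⇒fewer (λ _ _ → id) c c′) (coarser⇒fewer (λ _ _ → id) c′ c)

  -- Adding a single pair merges at most two classes of the closure, so class counts can be followed
  -- one pair at a time.
  Add : Rel A 0ℓ → A → A → Rel A 0ℓ
  Add Q x y a b = Q a b ⊎ (a ≡ x × b ≡ y)

  module _ {Q : Rel A 0ℓ} {x y : A} where

    private
      Q∗ = EqClosure Q

      old : Q∗ ⇒ EqClosure (Add Q x y)
      old = Eq.map inj₁

      new : EqClosure (Add Q x y) x y
      new = Eq.return (inj₂ (refl , refl))

    add-related : Q∗ x y → EqClosure (Add Q x y) ⇒ Q∗
    add-related xy = Eq.fold (Eq.isEquivalence Q) λ { (inj₁ q) → Eq.return q ; (inj₂ (refl , refl)) → xy }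

    private
      module Merge {k} (c : Q∗ HasClasses (suc k)) (¬xy : ¬ Q∗ x y) where

        class = proj₁ c
        eq    = proj₁ (proj₂ c)

        apart : class x ≢ class y
        apart = ¬xy ∘ from (eq x y)

        class′ : A → Fin k
        class′ = collapse apart ∘ class

        fwd : EqClosure (Add Q x y) ⇒ (λ a b → class′ a ≡ class′ b)
        fwd = Eq.fold (On.isEquivalence class′ ≡.isEquivalence) λ
          { (inj₁ q)             → cong (collapse apart) (to (eq _ _) (Eq.return q))
          ; (inj₂ (refl , refl)) → collapse-joins apart
          }

        Cases : A → A → Set
        Cases a b = Q∗ a b ⊎ (Q∗ a x × Q∗ y b) ⊎ (Q∗ a y × Q∗ x b)

        cases : ∀ {a b} → class′ a ≡ class′ b → Cases a b
        cases e with collapse-only apart e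
        ... | inj₁ p              = inj₁ (from (eq _ _) p)
        ... | inj₂ (inj₁ (p , q)) = inj₂ (inj₁ (from (eq _ _) p , from (eq _ _) (sym q)))
        ... | inj₂ (inj₂ (p , q)) = inj₂ (inj₂ (from (eq _ _) p , from (eq _ _) (sym q)))

        bwd : ∀ {a b} → class′ a ≡ class′ b → EqClosure (Add Q x y) a b
        bwd e with cases e
        ... | inj₁ ab              = old ab
        ... | inj₂ (inj₁ (p , q)) =
          Eq.transitive _ (old p) (Eq.transitive _ new (old q))
        ... | inj₂ (inj₂ (p , q)) =
          Eq.transitive _ (old p) (Eq.transitive _ (Eq.symmetric _ new) (old q))

        merged : EqClosure (Add Q x y) HasClasses k
        merged = class′ , (λ a b → mk⇔ fwd bwd) , λ t →
          let a , hit = proj₂ (proj₂ c) (punchIn (class y) t)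
          in a , λ { refl → trans (cong (collapse apart) (hit refl)) (collapse-punchIn apart t) }

    related? : ∀ {k} → Q∗ HasClasses k → Dec (Q∗ x y)
    related? (class , eq , _) = map′ (from (eq x y)) (to (eq x y)) (class x Fin.≟ class y)

    merge : ∀ {k} → Q∗ HasClasses k → ¬ Q∗ x y →
            ∃ λ l → k ≡ suc l × EqClosure (Add Q x y) HasClasses l
    merge {zero}  (class , _) _ with () ← class x
    merge {suc k} c ¬xy = k , refl , Merge.merged c ¬xy

    add-classes : ∀ {k} → Q∗ HasClasses k →
                  ∃ λ l → EqClosure (Add Q x y) HasClasses l × l ≤ k × k ≤ suc l
    add-classes {k} c with related? c
    ... | yes xy = k , classes-resp (λ _ _ → old) (λ _ _ → add-related xy) c , ≤-refl , n≤1+n k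
    ... | no ¬xy with merge c ¬xy
    ... | l , refl , c′ = l , c′ , n≤1+n l , ≤-refl

    add-cases : ∀ {k} → Q∗ HasClasses k → ∀ {a b} → EqClosure (Add Q x y) a b →
                Q∗ a b ⊎ (Q∗ a x × Q∗ y b) ⊎ (Q∗ a y × Q∗ x b)
    add-cases {k} c ab with related? c
    ... | yes xy = inj₁ (add-related xy ab)
    add-cases {zero}  (class , _) _ | no _ with () ← class x
    add-cases {suc k} c ab | no ¬xy = Merge.cases c ¬xy (Merge.fwd c ¬xy ab)

  add-swap : ∀ {P Q : Rel A 0ℓ} {x y} → P ⇒ EqClosure (Add Q x y) →
             EqClosure (Add P x y) ⇒ EqClosure (Add Q x y)
  add-swap {Q = Q} {x} {y} imp = Eq.fold (Eq.isEquivalence (Add Q x y))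
    λ { (inj₁ p) → imp p ; (inj₂ e) → Eq.return (inj₂ e) }

  -- g is f composed with the transposition of x and y.
  record Twisted (x y : A) (f g : A → A) : Set where
    field
      at-x      : g x ≡ f y
      at-y      : g y ≡ f x
      elsewhere : ∀ {z} → z ≢ x → z ≢ y → g z ≡ f z

  twisted-sym : ∀ {x y f g} → Twisted x y f g → Twisted x y g f
  twisted-sym t = record
    { at-x = sym (at-y t) ; at-y = sym (at-x t) ; elsewhere = λ p q → sym (elsewhere t p q) }
    where open Twisted

  iterate : (A → A) → ℕ → A → A
  iterate f zero    a = a
  iterate f (suc n) a = f (iterate f n a)

  iterate-+ : ∀ f k l a → iterate f (k + l) a ≡ iterate f k (iterate f l a)
  iterate-+ f zero    l a = refl
  iterate-+ f (suc k) l a = cong f (iterate-+ f k l a)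

  iterate-injective : ∀ {f} → Injective _≡_ _≡_ f → ∀ n → Injective _≡_ _≡_ (iterate f n)
  iterate-injective inj zero    e = e
  iterate-injective inj (suc n) e = iterate-injective inj n (inj e)

-- Counting orbits on a finite set

module FiniteOrbits {A : Set} (_≟_ : DecidableEquality A)
  (elements : List A) (∈elements : ∀ a → a ∈ elements) (unique : Unique elements) where

  index : A → Fin (length elements)
  index a = Any.index (∈elements a)

  index-injective : Injective _≡_ _≡_ index
  index-injective {a} {b} e =
    trans (lookup-index (∈elements a)) (trans (cong (lookup elements) e) (sym (lookup-index (∈elements b))))

  elements-classes : _≡_ HasClasses length elements
  elements-classes = index , (λ x y → mk⇔ (cong index) index-injective) ,
    λ i → lookup elements i ,
      λ { refl → lookup-injective unique (sym (lookup-index (∈elements (lookup elements i)))) }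

  Listed : List (A × A) → Rel A 0ℓ
  Listed ps a b = (a , b) ∈ ps

  -- Equality has one class per element, and the pairs are added one by one. This is what makes the
  -- numbers of orbits and components exist.
  listed-classes : ∀ ps → ∃ λ k → EqClosure (Listed ps) HasClasses k
  listed-classes [] = _ , classes-resp (λ { _ _ refl → Eq.reflexive _ })
    (λ _ _ → Eq.fold ≡.isEquivalence (λ ())) elements-classes
  listed-classes ((x , y) ∷ ps) with listed-classes ps
  ... | k , c with add-classes {x = x} {y} c
  ... | l , c′ , _ = l , classes-resp
    (λ _ _ → Eq.map λ { (inj₁ p) → there p ; (inj₂ (refl , refl)) → here refl })
    (λ _ _ → Eq.map λ { (here refl) → inj₂ (refl , refl) ; (there p) → inj₁ p }) c′

  graph : (A → A) → List (A × A)
  graph f = List.map (λ a → a , f a) elements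

  graph⁺ : ∀ {f a b} → f a ≡ b → (a , b) ∈ graph f
  graph⁺ {a = a} refl = ∈-map⁺ _ (∈elements a)

  graph⁻ : ∀ {f a b} → (a , b) ∈ graph f → f a ≡ b
  graph⁻ m with ∈-map⁻ _ m
  ... | _ , _ , refl = refl

  Linked : (A → A) → (A → A) → Rel A 0ℓ
  Linked f g a b = f a ≡ b ⊎ g a ≡ b

  orbit-classes : ∀ (f : A → A) → ∃ λ k → SameOrbit f HasClasses k
  orbit-classes f with listed-classes (graph f)
  ... | k , c = k , classes-resp (λ _ _ → Eq.map graph⁻) (λ _ _ → Eq.map graph⁺) c

  linked-classes : ∀ f g → ∃ λ k → EqClosure (Linked f g) HasClasses k
  linked-classes f g with listed-classes (graph f ++ graph g)
  ... | k , c = k , classes-resp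
    (λ _ _ → Eq.map (Sum.map graph⁻ graph⁻ ∘ ∈-++⁻ (graph f)))
    (λ _ _ → Eq.map [ ∈-++⁺ˡ ∘ graph⁺ , ∈-++⁺ʳ (graph f) ∘ graph⁺ ]′) c

  period : ∀ {f} → Injective _≡_ _≡_ f → ∀ a → ∃ λ n → iterate f (suc n) a ≡ a
  period {f} inj a with pigeonhole {length elements} ≤-refl (λ i → index (iterate f (toℕ i) a))
  ... | i , j , i<j , e with m≤n⇒∃[o]m+o≡n i<j
  ... | n , eq = n , sym (iterate-injective inj (toℕ i) (trans (index-injective e)
    (trans (cong (λ k → iterate f k a) (trans (sym eq) (sym (+-suc (toℕ i) n))))
           (iterate-+ f (toℕ i) (suc n) a))))

  orbit-sym : ∀ (f : A → A) {a b} → SameOrbit f a b → SameOrbit f b a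
  orbit-sym f = Eq.symmetric (λ x y → f x ≡ y)

  orbit-trans : ∀ (f : A → A) {a b c} → SameOrbit f a b → SameOrbit f b c → SameOrbit f a c
  orbit-trans f = Eq.transitive (λ x y → f x ≡ y)

  orbit-step : ∀ (f : A → A) {a} → SameOrbit f a (f a)
  orbit-step f = Eq.return refl

  iterate-orbit : ∀ (f : A → A) n a → SameOrbit f a (iterate f n a)
  iterate-orbit f zero    a = Eq.reflexive _
  iterate-orbit f (suc n) a = orbit-trans f (iterate-orbit f n a) (orbit-step f)

  module _ {f g : A → A} {x y : A} (twist : Twisted x y f g) where

    open Twisted twist

    -- An `f`-step from `x` is the link from `x` to `y` followed by a `g`-step, and likewise from
    -- `y`. By symmetry `f` and `g` generate the same relation once `x` and `y` are linked.
    twist-links : (λ a b → f a ≡ b) ⇒ EqClosure (Add (λ a b → g a ≡ b) x y)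
    twist-links {a} refl with a ≟ x | a ≟ y
    ... | no p     | no q     = Eq.return (inj₁ (elsewhere p q))
    ... | yes refl | _        = Eq.transitive _ (Eq.return (inj₂ (refl , refl))) (Eq.return (inj₁ at-y))
    ... | no _     | yes refl =
      Eq.transitive _ (Eq.symmetric _ (Eq.return (inj₂ (refl , refl)))) (Eq.return (inj₁ at-x))

    -- The f-orbit of x closes up at x without meeting y, so the g-orbit of y
    -- runs through all of it.
    twist-joins : Injective _≡_ _≡_ f → ¬ SameOrbit f x y → SameOrbit g x y
    twist-joins inj ¬xy with period inj x
    ... | n , back with along n
      where
      along : ∀ n → SameOrbit g y (iterate f (suc n) x) ⊎ SameOrbit g x y
      along zero = inj₁ (Eq.return at-y)
      along (suc n) with along n
      ... | inj₂ xy = inj₂ xy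
      ... | inj₁ yz with iterate f (suc n) x ≟ x | iterate f (suc n) x ≟ y
      ... | yes e | _     = inj₂ (orbit-sym g (subst (SameOrbit g y) e yz))
      ... | no _  | yes e = ⊥-elim (¬xy (subst (SameOrbit f x) e (iterate-orbit f (suc n) x)))
      ... | no p  | no q  = inj₁ (orbit-trans g yz (Eq.return (elsewhere p q)))
    ... | inj₂ xy = xy
    ... | inj₁ yx = orbit-sym g (subst (SameOrbit g y) back yx)

  -- Being equal to `a` is invariant along steps in both directions: forwards because `a` is fixed,
  -- backwards because `f` is injective.
  fixed-orbit : ∀ {f : A → A} → Injective _≡_ _≡_ f → ∀ {a b} → f a ≡ a → SameOrbit f a b → a ≡ b
  fixed-orbit {f} inj {a} fixed ab = to (Eq.fold iff (λ {c} {d} e → equiv e) ab) refl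
    where
    iff : IsEquivalence (λ c d → (a ≡ c) ⇔ (a ≡ d))
    iff = record
      { refl  = mk⇔ id id
      ; sym   = λ e → mk⇔ (from e) (to e)
      ; trans = λ e e′ → mk⇔ (to e′ ∘ to e) (from e ∘ from e′)
      }
    equiv : ∀ {c d} → f c ≡ d → (a ≡ c) ⇔ (a ≡ d)
    equiv refl = mk⇔ (λ { refl → sym fixed }) (λ e → inj (trans fixed e))

-- Euler's inequality for subgraphs

module Detaching {A : Set} (_≟_ : DecidableEquality A)
  (elements : List A) (∈elements : ∀ a → a ∈ elements) (unique : Unique elements)
  (rev : A → A) (rev-rev : ∀ a → rev (rev a) ≡ a) (E : ℕ) where

  open FiniteOrbits _≟_ elements ∈elements unique

  -- With an inequality, a detachment inside one component is harmless whichever way `F` changes: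
  -- the new vertex pays for at most one lost face. Preserving the equality would also require that
  -- the genus is never negative.
  record Balanced (f : A → A) : Set where
    field
      {V F C}    : ℕ
      vertices   : SameOrbit f HasClasses V
      faces      : SameOrbit (f ∘ rev) HasClasses F
      components : EqClosure (Linked rev f) HasClasses C
      euler      : E + 2 * C ≤ V + F

  transpose : A → A → A → A
  transpose x y z with z ≟ x | z ≟ y
  ... | yes _ | _     = y
  ... | no _  | yes _ = x
  ... | no _  | no _  = z

  module _ {x y : A} where

    transpose-x : transpose x y x ≡ y
    transpose-x with x ≟ x
    ... | yes _ = refl
    ... | no ¬e = ⊥-elim (¬e refl)

    transpose-y : transpose x y y ≡ x
    transpose-y with y ≟ x | y ≟ y
    ... | yes e | _     = e
    ... | no _  | yes _ = refl
    ... | no _  | no ¬e = ⊥-elim (¬e refl)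

    transpose-else : ∀ {z} → z ≢ x → z ≢ y → transpose x y z ≡ z
    transpose-else {z} p q with z ≟ x | z ≟ y
    ... | yes e | _     = ⊥-elim (p e)
    ... | no _  | yes e = ⊥-elim (q e)
    ... | no _  | no _  = refl

    transpose-involutive : ∀ z → transpose x y (transpose x y z) ≡ z
    transpose-involutive z with z ≟ x | z ≟ y
    ... | yes refl | _        = transpose-y
    ... | no _     | yes refl = transpose-x
    ... | no p     | no q     = transpose-else p q

    transpose-injective : Injective _≡_ _≡_ (transpose x y)
    transpose-injective e = trans (sym (transpose-involutive _))
      (trans (cong (transpose x y) e) (transpose-involutive _))

    twisted : ∀ (f : A → A) → Twisted x y f (f ∘ transpose x y)
    twisted f = record
      { at-x = cong f transpose-x ; at-y = cong f transpose-y
      ; elsewhere = λ p q → cong f (transpose-else p q) }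

    -- Faces are orbits of `f ∘ rev`, so they see the transposition conjugated by `rev`.
    twisted-faces : ∀ (f : A → A) → Twisted (rev x) (rev y) (f ∘ rev) (f ∘ transpose x y ∘ rev)
    twisted-faces f = record
      { at-x = cong f (trans (cong (transpose x y) (rev-rev x)) (trans transpose-x (sym (rev-rev y))))
      ; at-y = cong f (trans (cong (transpose x y) (rev-rev y)) (trans transpose-y (sym (rev-rev x))))
      ; elsewhere = λ p q → cong f (transpose-else (p ∘ move) (q ∘ move))
      }
      where
      move : ∀ {z w} → rev z ≡ w → z ≡ rev w
      move {z} refl = sym (rev-rev z)

  transpose-trivial : ∀ {x} z → transpose x x z ≡ z
  transpose-trivial {x} z with z ≟ x
  ... | yes e = sym e
  ... | no _  = refl

  -- f ∘ transpose x y fixes y and bypasses it.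
  module _ {f : A → A} (inj : Injective _≡_ _≡_ f) {x y : A} (fx : f x ≡ y) where

    private
      g = f ∘ transpose x y

      fixes : g y ≡ y
      fixes = trans (cong f transpose-y) fx

      g-inj : Injective _≡_ _≡_ g
      g-inj = transpose-injective ∘ inj

      Q R : Rel A 0ℓ
      Q a b = f a ≡ b
      R a b = g a ≡ b

      joined : EqClosure Q ⇒ EqClosure (Add R x y)
      joined = Eq.fold (Eq.isEquivalence _) (twist-links (twisted f))

      joined⁻ : EqClosure (Add R x y) ⇒ EqClosure Q
      joined⁻ = add-related (Eq.return fx) ∘ add-swap (twist-links (twisted-sym (twisted f)))

    -- The `f`-orbits are the `g`-orbits with `x` and `y` linked. As `y` is alone in its `g`-orbit,
    -- a connection that needs the link must begin or end at `y`.
    detach-bypasses : ∀ {a b} → a ≢ y → b ≢ y → SameOrbit f a b → SameOrbit g a b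
    detach-bypasses a≢y b≢y ab with add-cases (proj₂ (orbit-classes g)) (joined ab)
    ... | inj₁ ab′             = ab′
    ... | inj₂ (inj₁ (_ , yb)) = ⊥-elim (b≢y (sym (fixed-orbit g-inj fixes yb)))
    ... | inj₂ (inj₂ (ay , _)) = ⊥-elim (a≢y (sym (fixed-orbit g-inj fixes (orbit-sym g ay))))

    private
      trivial : x ≡ y → ∀ z → g z ≡ f z
      trivial refl z = cong f (transpose-trivial z)

      unchanged : (∀ z → g z ≡ f z) → Balanced f → Balanced g
      unchanged same bal = record
        { vertices   = classes-resp (λ _ _ → Eq.map λ {a} e → trans (same a) e)
                                    (λ _ _ → Eq.map λ {a} e → trans (sym (same a)) e) (Balanced.vertices bal)
        ; faces      = classes-resp (λ _ _ → Eq.map λ {a} e → trans (same (rev a)) e)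
                                    (λ _ _ → Eq.map λ {a} e → trans (sym (same (rev a))) e) (Balanced.faces bal)
        ; components = classes-resp
                         (λ _ _ → Eq.map λ { (inj₁ e) → inj₁ e ; (inj₂ e) → inj₂ (trans (same _) e) })
                         (λ _ _ → Eq.map λ { (inj₁ e) → inj₁ e ; (inj₂ e) → inj₂ (trans (sym (same _)) e) })
                         (Balanced.components bal)
        ; euler      = Balanced.euler bal
        }

      module Proper (x≢y : x ≢ y) (bal : Balanced f) where

        open Balanced bal

        V′ = proj₁ (orbit-classes g)
        vertices′ = proj₂ (orbit-classes g)
        F′ = proj₁ (orbit-classes (g ∘ rev))
        faces′ = proj₂ (orbit-classes (g ∘ rev))
        C′ = proj₁ (linked-classes rev g)
        components′ = proj₂ (linked-classes rev g)

        -- `y` has become an orbit of its own, and linking it to `x` restores the old orbits.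
        V′≡ : V′ ≡ suc V
        V′≡ with merge vertices′ (λ xy → x≢y (sym (fixed-orbit g-inj fixes (orbit-sym g xy))))
        ... | l , e , c = trans e (cong suc (classes-unique
              (classes-resp (λ _ _ → joined⁻) (λ _ _ → joined) c) vertices))

        P P′ : Rel A 0ℓ
        P  a b = f (rev a) ≡ b
        P′ a b = g (rev a) ≡ b

        to-P′ : EqClosure (Add P (rev x) (rev y)) ⇒ EqClosure (Add P′ (rev x) (rev y))
        to-P′ = add-swap (twist-links (twisted-faces f))

        to-P : EqClosure (Add P′ (rev x) (rev y)) ⇒ EqClosure (Add P (rev x) (rev y))
        to-P = add-swap (twist-links (twisted-sym (twisted-faces f)))

        -- Once `rev x` and `rev y` are linked, old and new faces generate the same relation. The
        -- link costs the old faces at most one class and gives the new ones none.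
        F≤ : F ≤ suc F′
        F≤ with add-classes {x = rev x} {rev y} faces | add-classes {x = rev x} {rev y} faces′
        ... | j , cj , _ , F≤sj | j′ , cj′ , j′≤F′ , _ =
          ≤-trans F≤sj (s≤s (≤-trans (≤-reflexive (classes-unique cj
            (classes-resp (λ _ _ → to-P) (λ _ _ → to-P′) cj′))) j′≤F′))

        L L′ : Rel A 0ℓ
        L  = Linked rev f
        L′ = Linked rev g

        linked : EqClosure L ⇒ EqClosure (Add L′ x y)
        linked = Eq.fold (Eq.isEquivalence _) λ
          { (inj₁ e) → Eq.return (inj₁ (inj₁ e))
          ; (inj₂ e) → Eq.map (Sum.map inj₂ id) (twist-links (twisted f) e) }

        linked⁻ : EqClosure (Add L′ x y) ⇒ EqClosure L
        linked⁻ = Eq.fold (Eq.isEquivalence _) λ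
          { (inj₁ (inj₁ e))      → Eq.return (inj₁ e)
          ; (inj₁ (inj₂ e))      → Eq.map inj₂ (joined⁻ (Eq.return (inj₁ e)))
          ; (inj₂ (refl , refl)) → Eq.return (inj₂ fx) }

        back : ∀ {k} → EqClosure (Add L′ x y) HasClasses k → k ≡ C
        back c = classes-unique (classes-resp (λ _ _ → linked⁻) (λ _ _ → linked) c) components

        turn : ∀ a → EqClosure L′ a (rev a)
        turn a = Eq.return (inj₁ refl)

        -- A face step is `rev` followed by `g`, so a face never leaves its component.
        ¬face : ¬ EqClosure L′ x y → ¬ EqClosure P′ (rev x) (rev y)
        ¬face ¬xy xy = ¬xy (Eq.transitive _ (turn x)
          (Eq.transitive _ (Eq.fold (Eq.isEquivalence _) step xy) (Eq.symmetric _ (turn y))))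
          where
          step : P′ ⇒ EqClosure L′
          step {a} e = Eq.transitive _ (turn a) (Eq.return (inj₂ e))

        -- When x and y fall into different components they were on one face,
        -- and this face falls apart as well.
        F′≡ : ¬ EqClosure L′ x y → F′ ≡ suc F
        F′≡ ¬xy with merge faces′ (¬face ¬xy)
        ... | l , e , c = trans e (cong suc (classes-unique
          (classes-resp (λ _ _ → add-related one-face ∘ to-P) (λ _ _ → to-P′ ∘ Eq.map inj₁) c) faces))
          where
          rev-inj : Injective _≡_ _≡_ rev
          rev-inj {a} {b} e = trans (sym (rev-rev a)) (trans (cong rev e) (rev-rev b))

          one-face : SameOrbit (f ∘ rev) (rev x) (rev y)
          one-face = twist-joins (twisted-sym (twisted-faces f)) (rev-inj ∘ g-inj) (¬face ¬xy)

        euler′ : E + 2 * C′ ≤ V′ + F′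
        euler′ with related? {x = x} {y} components′
        ... | yes xy = begin
          E + 2 * C′        ≡⟨ cong (λ c → E + 2 * c)
                                 (back (classes-resp (λ _ _ → Eq.map inj₁) (λ _ _ → add-related xy) components′)) ⟩
          E + 2 * C         ≤⟨ euler ⟩
          V + F             ≤⟨ +-monoʳ-≤ V F≤ ⟩
          V + suc F′        ≡⟨ +-suc V F′ ⟩
          suc V + F′        ≡⟨ cong (_+ F′) V′≡ ⟨
          V′ + F′           ∎
          where open ≤-Reasoning
        ... | no ¬xy with merge components′ ¬xy
        ... | l , e , c = begin
          E + 2 * C′        ≡⟨ cong (λ c → E + 2 * c) (trans e (cong suc (back c))) ⟩
          E + 2 * suc C     ≡⟨ shuffle E C ⟩
          2 + (E + 2 * C)   ≤⟨ +-monoʳ-≤ 2 euler ⟩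
          2 + (V + F)       ≡⟨ cong suc (+-suc V F) ⟨
          suc V + suc F     ≡⟨ cong₂ _+_ V′≡ (F′≡ ¬xy) ⟨
          V′ + F′           ∎
          where
          open ≤-Reasoning
          shuffle : ∀ e c → e + 2 * suc c ≡ 2 + (e + 2 * c)
          shuffle = solve-∀

    detach-balanced : Balanced f → Balanced g
    detach-balanced bal with x ≟ y
    ... | yes e  = unchanged (trivial e) bal
    ... | no x≢y = record { vertices = vertices′ ; faces = faces′ ; components = components′ ; euler = euler′ }
      where open Proper x≢y bal

  -- Every dart of ys has become a vertex of its own.
  record Detached {B : Set} (label : A → B) (f : A → A) (ys : List A) : Set where
    field
      after     : A → A
      injective : Injective _≡_ _≡_ after
      balanced  : Balanced after
      labelled  : ∀ a → label (after a) ≡ label a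
      fixed     : ∀ {y} → y ∈ ys → after y ≡ y
      orbits    : ∀ {a b} → ¬ a ∈ ys → ¬ b ∈ ys → SameOrbit f a b → SameOrbit after a b

  -- The label will be the source of a dart. Vertices are split, but no dart moves away from its
  -- source, so the new faces are still walks in the original graph.
  detach : ∀ {B : Set} (label : A → B) (f : A → A) → Injective _≡_ _≡_ f → Balanced f →
           (∀ a → label (f a) ≡ label a) → ∀ ys → Detached label f ys
  detach label f inj bal lab [] = record
    { after = f ; injective = inj ; balanced = bal ; labelled = lab ; fixed = λ () ; orbits = λ _ _ ab → ab }
  detach label f inj bal lab (y ∷ ys) = record
    { after     = after ∘ transpose x y
    ; injective = transpose-injective ∘ injective
    ; balanced  = detach-balanced injective fx balanced
    ; labelled  = relabelled
    ; fixed     = λ { (here refl) → trans (cong after transpose-y) fx ; (there m) → still (fixed m) }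
    ; orbits    = λ p q ab → detach-bypasses injective fx (p ∘ here) (q ∘ here)
                    (orbits (p ∘ there) (q ∘ there) ab)
    }
    where
    open Detached (detach label f inj bal lab ys)

    -- The predecessor of `y` in its current orbit, which exists because some positive iterate
    -- returns to `y`.
    x : A
    x = iterate after (proj₁ (period injective y)) y

    fx : after x ≡ y
    fx = proj₂ (period injective y)

    still : ∀ {z} → after z ≡ z → after (transpose x y z) ≡ z
    still {z} e with z ≟ x | z ≟ y
    ... | yes refl | _        = trans (cong after (trans (sym fx) e)) e
    ... | no _     | yes refl = fx
    ... | no _     | no _     = e

    relabelled : ∀ a → label (after (transpose x y a)) ≡ label a
    relabelled a with a ≟ x | a ≟ y
    ... | yes refl | _        = trans (labelled y) (trans (cong label (sym fx)) (labelled a))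
    ... | no _     | yes refl = cong label fx
    ... | no _     | no _     = labelled a

-- Listing the darts of a mask

module _ {n : ℕ} where

  pairs : Mask n → List (Fin n × Fin n)
  pairs h = filterᵇ (uncurry h) (cartesianProduct (allFin n) (allFin n))

  pairs-unique : ∀ h → Unique (pairs h)
  pairs-unique h = Unique.filter⁺ (T? ∘ uncurry h)
    (Unique.cartesianProduct⁺ (Unique.allFin⁺ n) (Unique.allFin⁺ n))

  ∈-pairs⁺ : ∀ {h u v} → T (h u v) → (u , v) ∈ pairs h
  ∈-pairs⁺ {h} {u} {v} uv = ∈-filter⁺ (T? ∘ uncurry h) (∈-cartesianProduct⁺ (∈-allFin u) (∈-allFin v)) uv

  ∈-pairs⁻ : ∀ {h u v} → (u , v) ∈ pairs h → T (h u v)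
  ∈-pairs⁻ {h} m = proj₂ (∈-filter⁻ (T? ∘ uncurry h) {xs = cartesianProduct (allFin n) (allFin n)} m)

  length-filter-map : ∀ {A B : Set} (p : B → Bool) (f : A → B) xs →
    length (filterᵇ p (List.map f xs)) ≡ length (filterᵇ (p ∘ f) xs)
  length-filter-map p f [] = refl
  length-filter-map p f (x ∷ xs) with p (f x)
  ... | true  = cong suc (length-filter-map p f xs)
  ... | false = length-filter-map p f xs

  length-pairs : ∀ h → length (pairs h) ≡ sum (deg h)
  length-pairs h = go n id
    where
    open ≡-Reasoning
    go : ∀ m (ι : Fin m → Fin n) →
         length (filterᵇ (uncurry h) (cartesianProduct (List.tabulate ι) (allFin n))) ≡ ∑[ i < m ] deg h (ι i)
    go zero    ι = refl
    go (suc m) ι = begin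
      length (filterᵇ (uncurry h) (row ++ rest))
        ≡⟨ cong length (List.filter-++ (T? ∘ uncurry h) row rest) ⟩
      length (filterᵇ (uncurry h) row ++ filterᵇ (uncurry h) rest)
        ≡⟨ List.length-++ (filterᵇ (uncurry h) row) ⟩
      length (filterᵇ (uncurry h) row) + length (filterᵇ (uncurry h) rest)
        ≡⟨ cong₂ _+_ (trans (length-filter-map (uncurry h) (ι zero ,_) (allFin n)) (length-filter (h (ι zero))))
                     (go m (ι ∘ suc)) ⟩
      deg h (ι zero) + ∑[ i < m ] deg h (ι (suc i)) ∎
      where
      row  = List.map (ι zero ,_) (allFin n)
      rest = cartesianProduct (List.tabulate (ι ∘ suc)) (allFin n)

length-cartesianProduct : ∀ {A B : Set} (xs : List A) (ys : List B) →
  length (cartesianProduct xs ys) ≡ length xs * length ys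
length-cartesianProduct []       ys = refl
length-cartesianProduct (x ∷ xs) ys = trans (List.length-++ (List.map (x ,_) ys))
  (cong₂ _+_ (List.length-map (x ,_) ys) (length-cartesianProduct xs ys))

combine-pair : ∀ {m k} → Fin m × Fin k → Fin (m * k)
combine-pair (i , j) = combine i j

combine-pair-injective : ∀ {m k} → Injective _≡_ _≡_ (combine-pair {m} {k})
combine-pair-injective {x = i , j} {i′ , j′} e with combine-injective i j i′ j′ e
... | refl , refl = refl

remQuot-injective : ∀ {m} k → Injective _≡_ _≡_ (remQuot {m} k)
remQuot-injective {m} k {x} {y} e =
  trans (sym (combine-remQuot {m} k x)) (trans (cong (uncurry combine) e) (combine-remQuot {m} k y))

splitAt-injective : ∀ m {k} → Injective _≡_ _≡_ (splitAt m {k})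
splitAt-injective m {k} {x} {y} e =
  trans (sym (join-splitAt m k x)) (trans (cong (Fin.join m k) e) (join-splitAt m k y))

-- Planar graphs of girth at least 6 are sparse

module PlanarSparse (G : Graph) (girth : 6 ≤girth G) (ρ : RotationSystem G) (ρ-planar : GenusZero G ρ) where

  open Graph G
  open RotationSystem ρ

  private
    E# : ℕ
    E# = proj₁ (proj₂ ρ-planar)

    counts = proj₂ (proj₂ (proj₂ (proj₂ ρ-planar)))

    edge-classes : SameEdge HasClasses E#
    edge-classes = proj₁ (proj₂ counts)

  no-loop : ∀ {u v} → Adj u v → u ≢ v
  no-loop {u} uv refl = subst T (adj-irrefl u) uv

  dart-≡′ : ∀ {d e : Dart} → src d ≡ src e → tgt d ≡ tgt e → d ≡ e
  dart-≡′ = dart-≡ G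

  rev-rev : ∀ d → rev (rev d) ≡ d
  rev-rev d = dart-≡′ refl refl

  rev≢ : ∀ d → rev d ≢ d
  rev≢ d e = no-loop (adjacent d) (sym (cong src e))

  allDarts : List Dart
  allDarts = List.deduplicate (_≟ᵈ_ G) (darts G)

  ∈-allDarts : ∀ d → d ∈ allDarts
  ∈-allDarts d = ∈-deduplicate⁺ (_≟ᵈ_ G) (∈-darts G d)

  allDarts-unique : Unique allDarts
  allDarts-unique = deduplicate-! (_≟ᵈ_ G) (darts G)

  open FiniteOrbits (_≟ᵈ_ G) allDarts ∈-allDarts allDarts-unique
  open Detaching (_≟ᵈ_ G) allDarts ∈-allDarts allDarts-unique rev rev-rev E#

  rotate-injective : Injective _≡_ _≡_ rotate
  rotate-injective {d} {e} eq = trans (sym (Inverse.strictlyInverseʳ rotation d))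
    (trans (cong (Inverse.from rotation) eq) (Inverse.strictlyInverseʳ rotation e))

  -- A path is followed by darts: rotate around the current vertex to the dart along the next edge,
  -- then reverse it.
  component⇒linked : ∀ {u v} → Star Adj u v → ∀ d e → src d ≡ u → src e ≡ v →
                     EqClosure (Linked rev rotate) d e
  component⇒linked ε d e refl e≡ = Eq.map inj₂ (cyclic d e (sym e≡))
  component⇒linked (_◅_ {j = w} uw path) d e refl e≡ =
    Eq.transitive _ (Eq.map inj₂ (cyclic d step refl))
      (Eq.transitive _ (Eq.return (inj₁ refl)) (component⇒linked path (rev step) e refl e≡))
    where
    step : Dart
    step = dart (src d) w uw

  linked⇒component : EqClosure (Linked rev rotate) ⇒ SameComponent G
  linked⇒component = Eq.fold record
    { refl  = ε
    ; sym   = Star.reverse (λ {u} {v} → subst T (adj-sym u v))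
    ; trans = _◅◅_
    } λ { {d} (inj₁ refl) → adjacent d ◅ ε
        ; {d} (inj₂ refl) → subst (Star Adj (src d)) (sym (rotate-src d)) ε }

  rotate-balanced : Balanced rotate
  rotate-balanced = record
    { vertices   = classes-resp cyclic (λ _ _ → Eq.fold (record { refl = refl ; sym = sym ; trans = trans })
                     λ { {d} refl → sym (rotate-src d) }) (proj₁ counts)
    ; faces      = proj₁ (proj₂ (proj₂ counts))
    ; components = classes-resp (λ d e path → component⇒linked path d e refl refl) (λ _ _ → linked⇒component)
                     (proj₁ (proj₂ (proj₂ (proj₂ counts))))
    ; euler      = ≤-reflexive (sym (proj₂ (proj₂ (proj₂ (proj₂ counts)))))
    }

  -- It tells the two darts of an edge apart, so an edge class and an orientation together determine
  -- a dart.
  orientation : Dart → Fin 2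
  orientation d with src d Fin.<? tgt d
  ... | yes _ = zero
  ... | no _  = suc zero

  orientation-rev : ∀ d → orientation (rev d) ≢ orientation d
  orientation-rev d with src d Fin.<? tgt d | tgt d Fin.<? src d
  ... | yes p | yes q = λ _ → <-asym p q
  ... | yes _ | no _  = λ ()
  ... | no _  | yes _ = λ ()
  ... | no p  | no q  = λ _ → no-loop (adjacent d) (toℕ-injective (≤-antisym (≮⇒≥ q) (≮⇒≥ p)))

  sameEdge-oriented : ∀ {d e} → SameEdge d e → orientation d ≡ orientation e → d ≡ e
  sameEdge-oriented (inj₁ refl) _     = refl
  sameEdge-oriented {d} (inj₂ refl) o = ⊥-elim (orientation-rev d (sym o))

  dartAt : ∀ {h} → h ⊑ adj → Fin (length (pairs h)) → Dart
  dartAt {h} h⊑ i = dart (proj₁ uv) (proj₂ uv) (h⊑ {proj₁ uv} {proj₂ uv} (∈-pairs⁻ {h = h} (∈-lookup i)))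
    where uv = lookup (pairs h) i

  dartAt-injective : ∀ {h} (h⊑ : h ⊑ adj) → Injective _≡_ _≡_ (dartAt {h} h⊑)
  dartAt-injective {h} h⊑ e = lookup-injective (pairs-unique h) (cong₂ _,_ (cong src e) (cong tgt e))

  adj-bound : sum (deg adj) ≤ E# * 2
  adj-bound = subst (_≤ E# * 2) (length-pairs adj) (injective⇒≤
    {f = combine-pair ∘ place ∘ dartAt {adj} id} λ e → dartAt-injective {adj} id (place-injective (combine-pair-injective e)))
    where
    place : Dart → Fin E# × Fin 2
    place d = proj₁ edge-classes d , orientation d
    place-injective : Injective _≡_ _≡_ place
    place-injective {d} {e} eq =
      sameEdge-oriented (from (proj₁ (proj₂ edge-classes) d e) (cong proj₁ eq)) (cong proj₂ eq)

  module _ (h : Mask order) where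

    Kept : Dart → Set
    Kept d = T (h (src d) (tgt d))

    kept? : ∀ d → Dec (Kept d)
    kept? d = T? (h (src d) (tgt d))

    lost : List Dart
    lost = List.filter (¬? ∘ kept?) allDarts

    lost⁺ : ∀ {d} → ¬ Kept d → d ∈ lost
    lost⁺ {d} ¬k = ∈-filter⁺ (¬? ∘ kept?) (∈-allDarts d) ¬k

    lost⁻ : ∀ {d} → d ∈ lost → ¬ Kept d
    lost⁻ m = proj₂ (∈-filter⁻ (¬? ∘ kept?) {xs = allDarts} m)

    module Submap (h-sym : Symmetric h) (h⊑adj : h ⊑ adj)
      (h-deg : ∀ {u v} → T (h u v) → 2 ≤ deg h u) (detached : Detached src rotate lost) where

      open Detached detached renaming (after to turn; injective to turn-injective)
      open Balanced balanced

      face : Dart → Dart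
      face = turn ∘ rev

      rev-kept : ∀ {d} → Kept d → Kept (rev d)
      rev-kept = flip-T {h = h} h-sym

      rev-lost : ∀ {d} → ¬ Kept d → ¬ Kept (rev d)
      rev-lost ¬k k = ¬k (flip-T {h = h} h-sym k)

      turn-lost : ∀ {d} → ¬ Kept d → turn d ≡ d
      turn-lost = fixed ∘ lost⁺

      -- A lost dart is a fixed point of the injective `turn`, so only itself can be sent to it.
      turn-kept : ∀ {d} → Kept d → Kept (turn d)
      turn-kept {d} k with kept? (turn d)
      ... | yes k′ = k′
      ... | no ¬k′ = subst Kept (sym (turn-injective (turn-lost ¬k′))) k

      face-kept : ∀ {d} → Kept d → Kept (face d)
      face-kept {d} k = turn-kept (rev-kept {d} k)

      iterate-kept : ∀ {d} k → Kept d → Kept (iterate face k d)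
      iterate-kept zero    kd = kd
      iterate-kept (suc k) kd = face-kept (iterate-kept k kd)

      orbit-kept : ∀ {d e} → Kept d → Kept e → src d ≡ src e → SameOrbit turn d e
      orbit-kept kd ke eq = orbits (λ m → lost⁻ m kd) (λ m → lost⁻ m ke) (cyclic _ _ eq)

      -- Minimum degree 2 enters here: `h` has another dart at the same vertex, in the same orbit of
      -- `turn`, whereas a fixed point is alone in its orbit.
      turn-moves : ∀ {d} → Kept d → turn d ≢ d
      turn-moves {d} kd still =
        proj₂ (without⁻ {r = h (src d)} (proj₂ other)) (sym (cong tgt
          (fixed-orbit turn-injective {b = neighbour} still (orbit-kept {e = neighbour} kd ko refl))))
        where
        other : ∃ λ v → T (without (h (src d)) (tgt d) v)
        other = count-some {r = without (h (src d)) (tgt d)}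
          (≤-pred (subst (2 ≤_) (count-without {r = h (src d)} (tgt d) kd) (h-deg {src d} {tgt d} kd)))
        ko = proj₁ (without⁻ {r = h (src d)} (proj₂ other))
        neighbour : Dart
        neighbour = dart (src d) (proj₁ other) (h⊑adj {src d} {proj₁ other} ko)

      module Walk (d : Dart) (kd : Kept d) where

        at : ℕ → Vertex
        at k = src (iterate face k d)

        at-suc : ∀ k → tgt (iterate face k d) ≡ at (suc k)
        at-suc k = sym (labelled (rev (iterate face k d)))

        at-adj : ∀ k → Adj (at k) (at (suc k))
        at-adj k = subst (Adj (at k)) (at-suc k) (adjacent (iterate face k d))

        at-1 : ∀ k → at k ≢ at (1 + k)
        at-1 k = no-loop (at-adj k)

        -- Otherwise the walk backtracks at the (k + 1)-st vertex.
        at-2 : ∀ k → at k ≢ at (2 + k)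
        at-2 k eq = turn-moves (rev-kept {iterate face k d} (iterate-kept k kd))
          (dart-≡′ (labelled (rev (iterate face k d))) (trans (at-suc (suc k)) (sym eq)))

        module _ (m : ℕ) (short : 3 + m ≤ 5) (closed : iterate face (3 + m) d ≡ d) where

          at-periodic : ∀ k → at (k + (3 + m)) ≡ at k
          at-periodic k = cong src (trans (iterate-+ face k (3 + m) d) (cong (iterate face k) closed))

          -- Positions on a cycle of length at most 5 are at distance at most 2.
          at-distinct : ∀ {i j} → i < j → j < 3 + m → at i ≢ at j
          at-distinct {i} {j} i<j j<p eq with m≤n⇒∃[o]m+o≡n i<j | m≤n⇒∃[o]m+o≡n j<p
          ... | 0 , refl | _ = at-1 i (trans eq (cong at (cong suc (+-identityʳ i))))
          ... | 1 , refl | _ =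
            at-2 i (trans eq (cong at (cong suc (trans (+-suc i 0) (cong suc (+-identityʳ i))))))
          -- The gap is now at least 3, so the way round through position 0 has length `t + i + 1`,
          -- which is at most 2.
          ... | suc (suc s) , refl | t , wrap = around (t + i) t+i≤1 refl
            where
            j′ = suc i + suc (suc s)

            t+i≤1 : t + i ≤ 1
            t+i≤1 = +-cancelˡ-≤ 4 (t + i) 1 (≤-trans (m≤m+n (4 + (t + i)) s)
              (≤-trans (≤-reflexive (trans (shape i s t) wrap)) short))
              where
              shape : ∀ i s t → 4 + (t + i) + s ≡ suc (suc i + suc (suc s)) + t
              shape = solve-∀

            wrapped : at j′ ≡ at (suc (t + i) + j′)
            wrapped = trans (sym eq) (trans (sym (at-periodic i))
              (cong at (trans (cong (i +_) (sym wrap)) (shape i j′ t))))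
              where
              shape : ∀ i j t → i + (suc j + t) ≡ suc (t + i) + j
              shape = solve-∀

            around : ∀ u → u ≤ 1 → u ≡ t + i → ⊥
            around 0 _ e = at-1 j′ (trans wrapped (cong (λ u → at (suc u + j′)) (sym e)))
            around 1 _ e = at-2 j′ (trans wrapped (cong (λ u → at (suc u + j′)) (sym e)))
            around (suc (suc _)) (s≤s ()) _

          cycle : Cycle G m
          cycle = record
            { vertex    = at ∘ toℕ
            ; injective = λ {i} {j} → vertex-injective i j
            ; step      = λ i → subst (λ k → Adj (at k) (at (suc (toℕ i)))) (sym (toℕ-inject₁ i)) (at-adj (toℕ i))
            ; close     = subst (λ k → Adj (at k) (at 0)) (sym (toℕ-fromℕ (2 + m)))
                            (subst (Adj (at (2 + m))) (at-periodic 0) (at-adj (2 + m)))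
            }
            where
            vertex-injective : ∀ i j → at (toℕ i) ≡ at (toℕ j) → i ≡ j
            vertex-injective i j eq with Fin.<-cmp i j
            ... | tri< i<j _ _ = ⊥-elim (at-distinct i<j (toℕ<n j) eq)
            ... | tri≈ _ e _   = e
            ... | tri> _ _ j<i = ⊥-elim (at-distinct j<i (toℕ<n i) (sym eq))

        -- The length is `suc p`. Length 1 would give a loop, length 2 a turn back, and lengths 3 to
        -- 5 a cycle that is too short.
        open-walk : ∀ p → p < 5 → iterate face (suc p) d ≢ d
        open-walk 0 _ closed = at-1 0 (sym (cong src closed))
        open-walk 1 _ closed = at-2 0 (sym (cong src closed))
        open-walk (suc (suc m)) p<5 closed = <⇒≱ (s≤s p<5) (girth m (cycle m p<5 closed))

      -- A repetition closes up the walk restarted at the `i`-th dart, which is kept as well. Thus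
      -- six distinct darts are found on the face without computing its length.
      face-long : ∀ {d} → Kept d → ∀ {i j} → i < j → j < 6 → iterate face i d ≢ iterate face j d
      face-long {d} kd {i} {j} i<j j<6 eq with m≤n⇒∃[o]m+o≡n i<j
      ... | p , refl = Walk.open-walk (iterate face i d) (iterate-kept i kd) p
        (≤-trans (s≤s (m≤n+m p i)) (≤-pred j<6))
        (trans (sym (iterate-+ face (suc p) i d))
          (trans (cong (λ k → iterate face k d) (cong suc (+-comm p i))) (sym eq)))

      missing : Mask order
      missing u v = adj u v ∧ not (h u v)

      missing⊑adj : missing ⊑ adj
      missing⊑adj {u} {v} t = proj₁ (∧⁻ {adj u v} t)

      missing-lost : ∀ {u v} → T (missing u v) → ¬ T (h u v)
      missing-lost {u} {v} t k with h u v | proj₂ (∧⁻ {adj u v} t)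
      ... | true | ()

      lost-missing : ∀ {d} → ¬ Kept d → T (missing (src d) (tgt d))
      lost-missing {d} ¬k = ∧⁺ (adjacent d) (negate (h (src d) (tgt d)) ¬k)
        where
        negate : ∀ b → ¬ T b → T (not b)
        negate true  ¬b = ⊥-elim (¬b tt)
        negate false _  = tt

      nH R : ℕ
      nH = sum (deg h)
      R  = sum (deg missing)

      present : Row order
      present v = 0 <ᵇ deg h v

      vH : ℕ
      vH = count present

      adj-split : sum (deg adj) ≡ nH + R
      adj-split = trans
        (sum-cong-≗ λ u → trans (sum-cong-≗ (split u)) (∑-distrib-+ (λ v → ⟦ h u v ⟧) (λ v → ⟦ missing u v ⟧)))
        (∑-distrib-+ (deg h) (deg missing))
        where
        split : ∀ u v → ⟦ adj u v ⟧ ≡ ⟦ h u v ⟧ + ⟦ missing u v ⟧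
        split u v with h u v | adj u v | h⊑adj {u} {v}
        ... | true  | true  | _ = refl
        ... | true  | false | k = ⊥-elim (k tt)
        ... | false | true  | _ = refl
        ... | false | false | _ = refl

      -- An orbit of `turn` is charged through its representative: to the source if that dart is
      -- kept, since the kept darts at a vertex share one orbit, and to the dart itself if it is
      -- lost.
      vertex-bound : V ≤ vH + R
      vertex-bound = ≤-trans (injection-into-list {xs = places} place place-injective place∈) (≤-reflexive length-places)
        where
        places : List (Vertex ⊎ (Vertex × Vertex))
        places = List.map inj₁ (filterᵇ present (allFin order)) ++ List.map inj₂ (pairs missing)

        length-places : length places ≡ vH + R
        length-places = trans (List.length-++ (List.map inj₁ (filterᵇ present (allFin order))))
          (cong₂ _+_ (trans (List.length-map inj₁ (filterᵇ present (allFin order))) (length-filter present))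
                     (trans (List.length-map inj₂ (pairs missing)) (length-pairs missing)))

        spot : ∀ d → Dec (Kept d) → Vertex ⊎ (Vertex × Vertex)
        spot d (yes _) = inj₁ (src d)
        spot d (no _)  = inj₂ (src d , tgt d)

        rep : Fin V → Dart
        rep i = proj₁ (representative vertices i)

        place : Fin V → Vertex ⊎ (Vertex × Vertex)
        place i = spot (rep i) (kept? (rep i))

        spot-orbit : ∀ {d e} (kd : Dec (Kept d)) (ke : Dec (Kept e)) → spot d kd ≡ spot e ke → SameOrbit turn d e
        spot-orbit (yes kd) (yes ke) eq = orbit-kept kd ke (inj₁-injective eq)
        spot-orbit {d} {e} (no _) (no _) eq
          with dart-≡′ {d} {e} (cong proj₁ (inj₂-injective eq)) (cong proj₂ (inj₂-injective eq))
        ... | refl = Eq.reflexive _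

        place-injective : Injective _≡_ _≡_ place
        place-injective {i} {j} eq = trans (sym (proj₂ (representative vertices i)))
          (trans (to (proj₁ (proj₂ vertices) _ _) (spot-orbit (kept? (rep i)) (kept? (rep j)) eq))
                 (proj₂ (representative vertices j)))

        place∈ : ∀ i → place i ∈ places
        place∈ i = spot∈ (rep i) (kept? (rep i))
          where
          spot∈ : ∀ d (k : Dec (Kept d)) → spot d k ∈ places
          spot∈ d (yes k) = ∈-++⁺ˡ
            (∈-map⁺ inj₁ (∈-filterᵇ {r = present} (<⇒<ᵇ (count-pos {r = h (src d)} (tgt d) k))))
          spot∈ d (no ¬k) = ∈-++⁺ʳ (List.map inj₁ (filterᵇ present (allFin order)))
            (∈-map⁺ inj₂ (∈-pairs⁺ {h = missing} (lost-missing {d} ¬k)))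

      -- A face of h contributes six of its darts, and the face of a lost edge
      -- its two darts three times each.
      face-bound : F * 6 ≤ nH + R * 3
      face-bound = ≤-trans (injection-into-list {xs = places} place place-injective place∈) (≤-reflexive length-places)
        where
        Place : Set
        Place = (Vertex × Vertex) × Fin 3

        places : List Place
        places = List.map (_, zero) (pairs h) ++ cartesianProduct (pairs missing) (allFin 3)

        length-places : length places ≡ nH + R * 3
        length-places = trans (List.length-++ (List.map (_, zero) (pairs h)))
          (cong₂ _+_ (trans (List.length-map (_, zero) (pairs h)) (length-pairs h))
                     (trans (length-cartesianProduct (pairs missing) (allFin 3)) (cong (_* 3) (length-pairs missing))))

        side : Dart → Fin 2 → Dart
        side d zero       = d
        side d (suc zero) = rev d

        spot : ∀ d → Dec (Kept d) → Fin 6 → Dart × Fin 3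
        spot d (yes _) j = iterate face (toℕ j) d , zero
        -- Since `6 = 2 * 3`, `j` encodes a side of the edge and one of three copies.
        spot d (no _)  j = side d (proj₁ (remQuot {2} 3 j)) , proj₂ (remQuot {2} 3 j)

        rep : Fin F → Dart
        rep i = proj₁ (representative faces i)

        ends : Dart × Fin 3 → Place
        ends (d , t) = (src d , tgt d) , t

        ends-injective : Injective _≡_ _≡_ ends
        ends-injective {d , _} {e , _} eq =
          cong₂ _,_ (dart-≡′ {d} {e} (cong (proj₁ ∘ proj₁) eq) (cong (proj₂ ∘ proj₁) eq)) (cong proj₂ eq)

        spotAt : Fin F × Fin 6 → Dart × Fin 3
        spotAt (i , j) = spot (rep i) (kept? (rep i)) j

        place : Fin (F * 6) → Place
        place = ends ∘ spotAt ∘ remQuot 6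

        spot-orbit : ∀ d k j → SameOrbit face d (proj₁ (spot d k j))
        spot-orbit d (yes _) j = iterate-orbit face (toℕ j) d
        spot-orbit d (no ¬k) j with proj₁ (remQuot {2} 3 j)
        ... | zero     = Eq.reflexive _
        -- `turn` fixes the lost dart `rev d`, so the face map sends `d` to `rev d`.
        ... | suc zero = Eq.return (turn-lost (rev-lost {d} ¬k))

        side-injective : ∀ d → Injective _≡_ _≡_ (side d)
        side-injective d {zero}     {zero}     _ = refl
        side-injective d {zero}     {suc zero} e = ⊥-elim (rev≢ d (sym e))
        side-injective d {suc zero} {zero}     e = ⊥-elim (rev≢ d e)
        side-injective d {suc zero} {suc zero} _ = refl

        spot-injective : ∀ d k → Injective _≡_ _≡_ (spot d k)
        spot-injective d (yes kd) {i} {j} eq with Fin.<-cmp i j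
        ... | tri< i<j _ _ = ⊥-elim (face-long kd i<j (toℕ<n j) (cong proj₁ eq))
        ... | tri≈ _ e _   = e
        ... | tri> _ _ j<i = ⊥-elim (face-long kd j<i (toℕ<n i) (sym (cong proj₁ eq)))
        spot-injective d (no _) eq =
          remQuot-injective 3 (cong₂ _,_ (side-injective d (cong proj₁ eq)) (cong proj₂ eq))

        spotAt-injective : Injective _≡_ _≡_ spotAt
        spotAt-injective {i , j} {i′ , j′} eq with trans (sym (proj₂ (representative faces i)))
          (trans (to (proj₁ (proj₂ faces) _ _) (orbit-trans face (spot-orbit (rep i) (kept? (rep i)) j)
            (subst (λ e → SameOrbit face e (rep i′)) (sym (cong proj₁ eq))
              (orbit-sym face (spot-orbit (rep i′) (kept? (rep i′)) j′)))))
            (proj₂ (representative faces i′)))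
        ... | refl = cong (i ,_) (spot-injective (rep i) (kept? (rep i)) eq)

        place-injective : Injective _≡_ _≡_ place
        place-injective eq = remQuot-injective {F} 6 (spotAt-injective (ends-injective eq))

        place∈ : ∀ t → place t ∈ places
        place∈ t = spot∈ (rep i) (kept? (rep i)) (proj₂ (remQuot {F} 6 t))
          where
          i = proj₁ (remQuot {F} 6 t)
          side-lost : ∀ {d} s → ¬ Kept d → ¬ Kept (side d s)
          side-lost zero       ¬k = ¬k
          side-lost {d} (suc zero) ¬k = rev-lost {d} ¬k
          spot∈ : ∀ d k j → ends (spot d k j) ∈ places
          spot∈ d (yes k) j = ∈-++⁺ˡ (∈-map⁺ (_, zero) (∈-pairs⁺ {h = h} (iterate-kept (toℕ j) k)))
          spot∈ d (no ¬k) j = ∈-++⁺ʳ (List.map (_, zero) (pairs h))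
            (∈-cartesianProduct⁺ (∈-pairs⁺ {h = missing} (lost-missing {side d s} (side-lost {d} s ¬k))) (∈-allFin _))
            where s = proj₁ (remQuot {2} 3 j)

      -- Neither `rev` nor `turn` leads into or out of the pair formed by `d` and `rev d`, as `turn`
      -- fixes both.
      lost-component : ∀ {d e} → ¬ Kept d → EqClosure (Linked rev turn) d e → SameEdge d e
      lost-component {d} ¬k de = to (Eq.fold iff link de) (inj₁ refl)
        where
        iff : IsEquivalence (λ a b → SameEdge d a ⇔ SameEdge d b)
        iff = record
          { refl  = mk⇔ id id
          ; sym   = λ e → mk⇔ (from e) (to e)
          ; trans = λ e e′ → mk⇔ (to e′ ∘ to e) (from e ∘ from e′)
          }

        flipped : ∀ {a} → SameEdge d a → SameEdge d (rev a)
        flipped (inj₁ refl) = inj₂ refl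
        flipped (inj₂ refl) = inj₁ (rev-rev d)

        still : ∀ {a} → SameEdge d a → turn a ≡ a
        still (inj₁ refl) = turn-lost ¬k
        still (inj₂ refl) = turn-lost (rev-lost {d} ¬k)

        link : Linked rev turn ⇒ (λ a b → SameEdge d a ⇔ SameEdge d b)
        link {a} (inj₁ refl) = mk⇔ flipped (subst (SameEdge d) (rev-rev a) ∘ flipped)
        link {a} (inj₂ refl) = mk⇔ (λ s → subst (SameEdge d) (sym (still s)) s)
          (λ s → subst (SameEdge d) (turn-injective (still s)) s)

      -- In terms of darts: each lost edge is a component of its own and carries two of the `R` lost
      -- darts. The component of `uv` is a further one, counted with both values of `Fin 2`.
      component-bound : ∀ {u v} → T (h u v) → R + 2 ≤ C * 2
      component-bound {u} {v} uv = subst (λ r → r + 2 ≤ C * 2) (length-pairs missing)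
        (injective⇒≤ {f = combine-pair ∘ place ∘ splitAt M} λ e →
          splitAt-injective M (place-injective (combine-pair-injective e)))
        where
        M = length (pairs missing)

        d₀ : Dart
        d₀ = dart u v (h⊑adj uv)

        cls : Dart → Fin C
        cls = proj₁ components

        lostAt : Fin M → Dart
        lostAt = dartAt {missing} missing⊑adj

        lostAt-lost : ∀ i → ¬ Kept (lostAt i)
        lostAt-lost i = missing-lost {src (lostAt i)} {tgt (lostAt i)} (∈-pairs⁻ {h = missing} (∈-lookup i))

        place : Fin M ⊎ Fin 2 → Fin C × Fin 2
        place (inj₁ i) = cls (lostAt i) , orientation (lostAt i)
        place (inj₂ b) = cls d₀ , b

        same : ∀ {i e} → cls (lostAt i) ≡ cls e → SameEdge (lostAt i) e
        same {i} {e} eq = lost-component (lostAt-lost i) (from (proj₁ (proj₂ components) (lostAt i) e) eq)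

        apart : ∀ i → cls (lostAt i) ≢ cls d₀
        apart i eq with same {i} eq
        ... | inj₁ e = lostAt-lost i (subst Kept e uv)
        ... | inj₂ e = rev-lost {lostAt i} (lostAt-lost i) (subst Kept e uv)

        place-injective : Injective _≡_ _≡_ place
        place-injective {inj₁ i} {inj₁ j} eq = cong inj₁ (dartAt-injective {missing} missing⊑adj
          (sameEdge-oriented (same {i} (cong proj₁ eq)) (cong proj₂ eq)))
        place-injective {inj₁ i} {inj₂ _} eq = ⊥-elim (apart i (cong proj₁ eq))
        place-injective {inj₂ _} {inj₁ j} eq = ⊥-elim (apart j (sym (cong proj₁ eq)))
        place-injective {inj₂ _} {inj₂ _} eq = cong inj₂ (cong proj₂ eq)

      -- Six times Euler's inequality, with the bounds on edges, components, vertices and faces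
      -- inserted. A lost dart weighs 9 on each side and cancels; what is left is `nH + 6 ≤ 3 * vH`.
      sparse-bound : ∀ {u v} → T (h u v) → nH < 3 * vH
      sparse-bound uv = ≤-trans (m<m+n nH {6} z<s) (*-cancelˡ-≤ 2 (+-cancelʳ-≤ (nH + 9 * R) _ _ (begin
        2 * (nH + 6) + (nH + 9 * R)               ≡⟨ lhs nH R ⟩
        3 * (nH + R) + 6 * (R + 2)                ≤⟨ +-mono-≤ (*-monoʳ-≤ 3 edges) (*-monoʳ-≤ 6 (component-bound uv)) ⟩
        3 * (E# * 2) + 6 * (C * 2)                ≡⟨ mid E# C ⟩
        6 * (E# + 2 * C)                          ≤⟨ *-monoʳ-≤ 6 euler ⟩
        6 * (V + F)                               ≡⟨ mid′ V F ⟩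
        6 * V + F * 6                             ≤⟨ +-mono-≤ (*-monoʳ-≤ 6 vertex-bound) face-bound ⟩
        6 * (vH + R) + (nH + R * 3)               ≡⟨ rhs vH nH R ⟩
        2 * (3 * vH) + (nH + 9 * R)               ∎)))
        where
        open ≤-Reasoning
        edges : nH + R ≤ E# * 2
        edges = subst (_≤ E# * 2) adj-split adj-bound
        lhs : ∀ n r → 2 * (n + 6) + (n + 9 * r) ≡ 3 * (n + r) + 6 * (r + 2)
        lhs = solve-∀
        mid : ∀ e c → 3 * (e * 2) + 6 * (c * 2) ≡ 6 * (e + 2 * c)
        mid = solve-∀
        mid′ : ∀ v f → 6 * (v + f) ≡ 6 * v + f * 6
        mid′ = solve-∀
        rhs : ∀ v n r → 6 * (v + r) + (n + r * 3) ≡ 2 * (3 * v) + (n + 9 * r)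
        rhs = solve-∀

  planar-sparse : Sparse adj
  planar-sparse h h-sym h⊑adj h-deg uv = Submap.sparse-bound h h-sym
    (λ {u} {v} → h⊑adj {u} {v}) (λ {u} {v} → h-deg {u} {v})
    (detach src rotate rotate-injective rotate-balanced rotate-src (lost h)) uv

-- From matrices back to graphs and darts

module _ (G : Graph) where

  open Graph G

  degree≡deg : ∀ v → degree v ≡ deg adj v
  degree≡deg v = go (adj v)
    where
    go : ∀ {n} (r : Row n) → ∣ Vec.tabulate r ∣ ≡ count r
    go {zero}  r = refl
    go {suc n} r with r zero
    ... | true  = cong suc (go (r ∘ suc))
    ... | false = go (r ∘ suc)

  deg≤Δ : ∀ v → deg adj v ≤ Δ G
  deg≤Δ v = subst (_≤ Δ G) (degree≡deg v)
    (All.lookup (xs≤max 0 (List.map degree (allFin order))) (∈-map⁺ degree (∈-allFin v)))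

  -- `Near` for two darts unfolds to `Close` for their endpoints, so its witness is passed on
  -- unchanged.
  proper⇒strong : ∀ {k} → ∃ (Greedy.Proper {k = k} adj adj-sym adj) → StrongEdgeColourable G k
  proper⇒strong (c , proper) = (λ d → c (src d) (tgt d)) ,
    (λ d → symmetric (tgt d) (src d)) ,
    λ d e ¬same near → strong (src d) (tgt d) (src e) (tgt e) (adjacent d) (adjacent e)
      (λ { (inj₁ (p , q)) → ¬same (inj₁ (dart-≡ G p q))
         ; (inj₂ (p , q)) → ¬same (inj₂ (dart-≡ G p q)) }) near
    where open Greedy.Proper proper

theorem8 : (G : Graph) → Planar G → 6 ≤girth G → χ′ₛ G ≤ 3 * Δ G + 1
theorem8 G (ρ , ρ-planar) girth = proj₂ (χ′ₛ-least G) (3 * Δ G + 1)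
  (subst (StrongEdgeColourable G) (+-comm 1 (3 * Δ G))
    (proper⇒strong G (sparse-colouring (Δ G) adj adj-sym (deg≤Δ G)
      (PlanarSparse.planar-sparse G girth ρ ρ-planar))))
  where open Graph G
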